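{- Let $n\ge 3$. The $n\times n$ matrix $$B_{n} = \begin{pmatrix} 0 & 1 & 2 & 4 & 8 & \cdots & 2^{n-2} \\ 1 & 0 & 1 & 2 & 4 & \cdots & 2^{n-3} \\ 0 & 1 & 0 & 1 & 2 & \cdots & 2^{n-4} \\ 0 & 0 & 1 & 0 & 1 & \cdots & 2^{n-5} \\ 0 & 0 & 0 & 1 & 0 & \cdots & 2^{n-6} \\ \vdots & \vdots & \vdots & \vdots & \vdots & \ddots & \vdots \\ 0 & 0 & 0 & 0 & 0 & \cdots & 0 \end{pmatrix}$$ (whose $(p,q)$ entry is $2^{q-p-1}$ if $q>p$, $0$ if $q=p$, $1$ if $q=p-1$, and $0$ if $q<p-1$) is a production matrix for non-crossing partitions of point sets in convex position; that is, $v^{i+1}=B_n v^i$ for all $i\ge 1$ with $i+2\le n$.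
   Context: A partition of $[i]=\{1,\dots,i\}$ into nonempty, pairwise disjoint blocks is non-crossing if whenever $1\le a<b<c<d\le i$ are such that $a,c$ are in the same block and $b,d$ are in the same block, the two blocks coincide. A non-crossing partition is drawn as a plane geometric graph on points $p_1,\dots,p_i$ in convex position labelled in counter-clockwise order: each block with at least three elements is drawn as the convex polygon (cycle) through its points, a block of size two as the edge joining its two points, and a block of size one as an isolated vertex. Two vertices are visible (from each other) if the line segment connecting them does not intersect the interior of any edge of the graph. The isolation degree of the root vertex $p_i$ is the number of isolated vertices (singleton blocks) that are visible from an additional vertex $p_{i+1}$ inserted between $p_i$ and $p_1$ in convex position; it is between $0$ and $i$. For $1\le i\le n-1$, $v^i$ is the $n$-dimensional column vector whose $j$-th entry is the number of non-crossing partitions with $i$ vertices whose root vertex has isolation degree $j-1$ (so $v^1=(0,1,0,\dots,0)^\top$). A production matrix is a matrix satisfying $v^{i+1}=B_nv^i$. -}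

module Defs where

open import Level using (Level; _⊔_)
open import Algebra.Bundles using (CommutativeRing)
open import Algebra.Solver.Ring.AlmostCommutativeRing
  using (fromCommutativeRing; _-Raw-AlmostCommutative⟶_)
open import Data.Bool.Base using (if_then_else_)
import Data.Bool.Properties as Bool
open import Data.Fin.Base as Fin using (Fin; toℕ; inject₁; fromℕ)
import Data.Fin.Properties as Fin
open import Data.Fin.Subset using (Subset; inside; outside; ⁅_⁆; _∈_)
open import Data.Fin.Subset.Properties using (_∈?_)
open import Data.Integer.Base as ℤ using (ℤ)
import Data.Integer.Properties as ℤ
open import Data.List.Base using (List; []; _∷_; [_]; allFin; cartesianProductWith; filter; length)
open import Data.Maybe.Base using (Maybe; just; nothing)
open import Data.Nat.Base as ℕ using (ℕ; zero; suc)
import Data.Nat.Properties as ℕ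
open import Data.Product.Base using (∃; _×_; _,_; proj₁; proj₂)
open import Data.Sum.Base using (_⊎_; inj₁; inj₂)
open import Data.Vec.Base using (Vec; []; _∷_; lookup)
import Data.Vec.Properties as Vec
open import Data.Vec.Functional using (Vector)
open import Relation.Binary.Core using (Rel)
open import Relation.Binary.Definitions using (tri<; tri≈; tri>)
open import Relation.Binary.PropositionalEquality as ≡ using (_≡_; _≢_)
open import Relation.Binary.Structures using (IsStrictTotalOrder)
open import Relation.Nullary.Decidable using (Dec; yes; no; ⌊_⌋; _×-dec_; _⊎-dec_; _→-dec_; ¬?; map′)
open import Relation.Nullary.Negation using (¬_; contradiction)
open import Algebra.Properties.Semiring.Sum ℕ.+-*-semiring using (sum)

-- The plane is taken over an arbitrary ordered field in place of ℝ.  The order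
-- is trichotomous, as it is classically for ℝ; visibility is then decidable and
-- the partitions can be counted.

record OrderedField c ℓ₁ ℓ₂ : Set (Level.suc (c ⊔ ℓ₁ ⊔ ℓ₂)) where
  infix 4 _<_ _≤_
  field
    commutativeRing : CommutativeRing c ℓ₁
  open CommutativeRing commutativeRing public
  field
    _<_                : Rel Carrier ℓ₂
    isStrictTotalOrder : IsStrictTotalOrder _≈_ _<_
    +-monoˡ-<          : ∀ z {x y} → x < y → x + z < y + z
    *-pos              : ∀ {x y} → 0# < x → 0# < y → 0# < x * y
    inverse            : ∀ x → ¬ x ≈ 0# → ∃ λ y → x * y ≈ 1#
    0≉1                : ¬ 0# ≈ 1#

  _≤_ : Rel Carrier (ℓ₁ ⊔ ℓ₂)
  x ≤ y = x < y ⊎ x ≈ y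

module _ {c ℓ₁ ℓ₂ : Level} (F : OrderedField c ℓ₁ ℓ₂) where
  open OrderedField F

  Point : Set c
  Point = Carrier × Carrier

  infix 4 _≈ₚ_
  _≈ₚ_ : Rel Point ℓ₁
  (x , y) ≈ₚ (x′ , y′) = x ≈ x′ × y ≈ y′

  lerp : Carrier → Point → Point → Point
  lerp t (x , y) (x′ , y′) =
    (1# - t) * x + t * x′ , (1# - t) * y + t * y′

  OnSegment : Point → Point → Point → Set (c ⊔ ℓ₁ ⊔ ℓ₂)
  OnSegment p q z = ∃ λ t → 0# ≤ t × t ≤ 1# × z ≈ₚ lerp t p q

  InInterior : Point → Point → Point → Set (c ⊔ ℓ₁ ⊔ ℓ₂)
  InInterior p q z = ∃ λ t → 0# < t × t < 1# × z ≈ₚ lerp t p q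

  MeetsInterior : (p q a b : Point) → Set (c ⊔ ℓ₁ ⊔ ℓ₂)
  MeetsInterior p q a b = ∃ λ z → OnSegment p q z × InInterior a b z

  -- Twice the signed area of the triangle abc; positive exactly when
  -- a, b, c make a counter-clockwise turn.
  orient : Point → Point → Point → Carrier
  orient (ax , ay) (bx , by) (cx , cy) =
    (bx - ax) * (cy - ay) - (by - ay) * (cx - ax)

  -- Points in convex position, listed in counter-clockwise order.
  record ConvexPointSet (m : ℕ) : Set (c ⊔ ℓ₁ ⊔ ℓ₂) where
    field
      pt       : Fin m → Point
      distinct : ∀ {a b} → a ≢ b → ¬ pt a ≈ₚ pt b
      ccw      : ∀ {a b c} → a Fin.< b → b Fin.< c → 0# < orient (pt a) (pt b) (pt c)

-- A set partition of Fin i is stored as the map sending each element to the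
-- block containing it, so that distinct vectors are distinct partitions.

BlockMap : ℕ → Set
BlockMap i = Vec (Subset i) i

module _ {i : ℕ} (π : BlockMap i) where

  block : Fin i → Subset i
  block = lookup π

  IsPartition : Set
  IsPartition = (∀ k → k ∈ block k) × (∀ k l → l ∈ block k → block l ≡ block k)

  IsNonCrossing : Set
  IsNonCrossing = ∀ a b c d → a Fin.< b → b Fin.< c → c Fin.< d →
                  c ∈ block a → d ∈ block b → block a ≡ block b

  IsNCPartition : Set
  IsNCPartition = IsPartition × IsNonCrossing

  Isolated : Fin i → Set
  Isolated k = block k ≡ ⁅ k ⁆

  -- The edges {a, b} of the drawing, with a < b: the points of a block form a
  -- convex polygon whose sides join successive points of the block, and the
  -- last point to the first.  In a block of size two both alternatives hold.
  IsEdge : Fin i → Fin i → Set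
  IsEdge a b = a Fin.< b × b ∈ block a ×
    ( (∀ c → c ∈ block a → ¬ (a Fin.< c × c Fin.< b))
    ⊎ (∀ c → c ∈ block a → a Fin.≤ c × c Fin.≤ b) )

  private
    infix 4 _≟ₛ_
    _≟ₛ_ : (s t : Subset i) → Dec (s ≡ t)
    _≟ₛ_ = Vec.≡-dec Bool._≟_

  isPartition? : Dec IsPartition
  isPartition? = Fin.all? (λ k → k ∈? block k)
           ×-dec Fin.all? (λ k → Fin.all? λ l → l ∈? block k →-dec (block l ≟ₛ block k))

  isNonCrossing? : Dec IsNonCrossing
  isNonCrossing? =
    Fin.all? λ a → Fin.all? λ b → Fin.all? λ c → Fin.all? λ d →
      a Fin.<? b →-dec (b Fin.<? c →-dec (c Fin.<? d →-dec
      (c ∈? block a →-dec (d ∈? block b →-dec (block a ≟ₛ block b)))))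

  isNCPartition? : Dec IsNCPartition
  isNCPartition? = isPartition? ×-dec isNonCrossing?

  isolated? : ∀ k → Dec (Isolated k)
  isolated? k = block k ≟ₛ ⁅ k ⁆

  isEdge? : ∀ a b → Dec (IsEdge a b)
  isEdge? a b = a Fin.<? b ×-dec b ∈? block a ×-dec
    ( Fin.all? (λ c → c ∈? block a →-dec ¬? (a Fin.<? c ×-dec c Fin.<? b))
    ⊎-dec Fin.all? (λ c → c ∈? block a →-dec (a Fin.≤? c ×-dec c Fin.≤? b)) )

module _ {c ℓ₁ ℓ₂ : Level} (F : OrderedField c ℓ₁ ℓ₂) where
  open OrderedField F

  private
    open import Algebra.Properties.Ring ring using (-0#≈0#; -‿distribˡ-*; -‿distribʳ-*; -‿involutive)
    open import Algebra.Properties.AbelianGroup +-abelianGroup using (⁻¹-∙-comm)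
    open import Algebra.Properties.Semiring.Mult.TCOptimised semiring
      using (1+×; ×-homo-+; ×1-homo-*) renaming (_×_ to _·_)
    open import Relation.Binary.Reasoning.Setoid setoid
    open IsStrictTotalOrder isStrictTotalOrder
      using (compare; irrefl; <-respˡ-≈; <-respʳ-≈)
      renaming (trans to <-trans)

    -- Integer coefficients for the ring solver: cancellation has to compute,
    -- which the operations of F do not.

    ⟦_⟧ : ℤ → Carrier
    ⟦ ℤ.+ n ⟧      = n · 1#
    ⟦ ℤ.-[1+ n ] ⟧ = - (suc n · 1#)

    ⟦-⟧ : ∀ z → ⟦ ℤ.- z ⟧ ≈ - ⟦ z ⟧
    ⟦-⟧ (ℤ.+ zero)    = sym -0#≈0#
    ⟦-⟧ (ℤ.+ suc n)   = refl
    ⟦-⟧ ℤ.-[1+ n ]    = sym (-‿involutive _)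

    cancel : ∀ x u w → (x + u) - (x + w) ≈ u - w
    cancel x u w = begin
      (x + u) - (x + w)       ≈⟨ +-cong (+-comm x u) (sym (⁻¹-∙-comm x w)) ⟩
      (u + x) + (- x + - w)   ≈⟨ +-assoc u x _ ⟩
      u + (x + (- x + - w))   ≈⟨ +-congˡ (sym (+-assoc x _ _)) ⟩
      u + ((x + - x) + - w)   ≈⟨ +-congˡ (+-congʳ (-‿inverseʳ x)) ⟩
      u + (0# + - w)          ≈⟨ +-congˡ (+-identityˡ _) ⟩
      u - w                   ∎

    ⟦⊖⟧ : ∀ m n → ⟦ m ℤ.⊖ n ⟧ ≈ m · 1# - n · 1#
    ⟦⊖⟧ m       zero    = sym (trans (+-congˡ -0#≈0#) (+-identityʳ _))
    ⟦⊖⟧ zero    (suc n) = sym (+-identityˡ _)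
    ⟦⊖⟧ (suc m) (suc n) = begin
      ⟦ suc m ℤ.⊖ suc n ⟧       ≡⟨ ≡.cong ⟦_⟧ (ℤ.[1+m]⊖[1+n]≡m⊖n m n) ⟩
      ⟦ m ℤ.⊖ n ⟧               ≈⟨ ⟦⊖⟧ m n ⟩
      m · 1# - n · 1#           ≈⟨ cancel 1# _ _ ⟨
      (1# + m · 1#) - (1# + n · 1#)
        ≈⟨ +-cong (1+× m 1#) (-‿cong (1+× n 1#)) ⟨
      suc m · 1# - suc n · 1#   ∎

    ⟦+⟧ : ∀ x y → ⟦ x ℤ.+ y ⟧ ≈ ⟦ x ⟧ + ⟦ y ⟧
    ⟦+⟧ (ℤ.+ m)    (ℤ.+ n)    = ×-homo-+ 1# m n
    ⟦+⟧ (ℤ.+ m)    ℤ.-[1+ n ] = ⟦⊖⟧ m (suc n)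
    ⟦+⟧ ℤ.-[1+ m ] (ℤ.+ n)    = trans (⟦⊖⟧ n (suc m)) (+-comm _ _)
    ⟦+⟧ ℤ.-[1+ m ] ℤ.-[1+ n ] = begin
      - (suc (suc (m ℕ.+ n)) · 1#)      ≡⟨ ≡.cong (λ k → - (k · 1#)) (≡.sym (ℕ.+-suc (suc m) n)) ⟩
      - ((suc m ℕ.+ suc n) · 1#)        ≈⟨ -‿cong (×-homo-+ 1# (suc m) (suc n)) ⟩
      - (suc m · 1# + suc n · 1#)       ≈⟨ ⁻¹-∙-comm _ _ ⟨
      - (suc m · 1#) - suc n · 1#       ∎

    ⟦*⟧⁺ : ∀ m n → ⟦ ℤ.+ m ℤ.* ℤ.+ n ⟧ ≈ m · 1# * (n · 1#)
    ⟦*⟧⁺ m n = trans (reflexive (≡.cong ⟦_⟧ (≡.sym (ℤ.pos-* m n)))) (×1-homo-* m n)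

    ⟦*⟧ : ∀ x y → ⟦ x ℤ.* y ⟧ ≈ ⟦ x ⟧ * ⟦ y ⟧
    ⟦*⟧ (ℤ.+ m)    (ℤ.+ n)    = ⟦*⟧⁺ m n
    ⟦*⟧ (ℤ.+ m)    ℤ.-[1+ n ] = begin
      ⟦ ℤ.+ m ℤ.* (ℤ.- (ℤ.+ suc n)) ⟧  ≡⟨ ≡.cong ⟦_⟧ (≡.sym (ℤ.neg-distribʳ-* (ℤ.+ m) (ℤ.+ suc n))) ⟩
      ⟦ ℤ.- (ℤ.+ m ℤ.* ℤ.+ suc n) ⟧    ≈⟨ ⟦-⟧ (ℤ.+ m ℤ.* ℤ.+ suc n) ⟩
      - ⟦ ℤ.+ m ℤ.* ℤ.+ suc n ⟧        ≈⟨ -‿cong (⟦*⟧⁺ m (suc n)) ⟩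
      - (m · 1# * (suc n · 1#))        ≈⟨ -‿distribʳ-* _ _ ⟩
      m · 1# * - (suc n · 1#)          ∎
    ⟦*⟧ ℤ.-[1+ m ] (ℤ.+ n)    = begin
      ⟦ (ℤ.- (ℤ.+ suc m)) ℤ.* ℤ.+ n ⟧  ≡⟨ ≡.cong ⟦_⟧ (≡.sym (ℤ.neg-distribˡ-* (ℤ.+ suc m) (ℤ.+ n))) ⟩
      ⟦ ℤ.- (ℤ.+ suc m ℤ.* ℤ.+ n) ⟧    ≈⟨ ⟦-⟧ (ℤ.+ suc m ℤ.* ℤ.+ n) ⟩
      - ⟦ ℤ.+ suc m ℤ.* ℤ.+ n ⟧        ≈⟨ -‿cong (⟦*⟧⁺ (suc m) n) ⟩
      - (suc m · 1# * (n · 1#))        ≈⟨ -‿distribˡ-* _ _ ⟩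
      - (suc m · 1#) * (n · 1#)        ∎
    ⟦*⟧ ℤ.-[1+ m ] ℤ.-[1+ n ] = begin
      ⟦ ℤ.+ suc m ℤ.* ℤ.+ suc n ⟧          ≈⟨ ⟦*⟧⁺ (suc m) (suc n) ⟩
      suc m · 1# * (suc n · 1#)            ≈⟨ -‿involutive _ ⟨
      - (- (suc m · 1# * (suc n · 1#)))    ≈⟨ -‿cong (-‿distribˡ-* _ _) ⟩
      - (- (suc m · 1#) * (suc n · 1#))    ≈⟨ -‿distribʳ-* _ _ ⟩
      - (suc m · 1#) * - (suc n · 1#)      ∎

    morphism : ℤ.+-*-rawRing -Raw-AlmostCommutative⟶ fromCommutativeRing commutativeRing
    morphism = record
      { ⟦_⟧    = ⟦_⟧
      ; +-homo = ⟦+⟧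
      ; *-homo = ⟦*⟧
      ; -‿homo = ⟦-⟧
      ; 0-homo = refl
      ; 1-homo = refl
      }

    _coeff≟_ : ∀ x y → Maybe (⟦ x ⟧ ≈ ⟦ y ⟧)
    x coeff≟ y with x ℤ.≟ y
    ... | yes x≡y = just (reflexive (≡.cong ⟦_⟧ x≡y))
    ... | no  _   = nothing

    open import Algebra.Solver.Ring ℤ.+-*-rawRing (fromCommutativeRing commutativeRing) morphism _coeff≟_

    𝟙 : ∀ {n} → Polynomial n
    𝟙 = con (ℤ.+ 1)

    lerp′ : ∀ {n} (t x y : Polynomial n) → Polynomial n
    lerp′ t x y = (𝟙 :- t) :* x :+ t :* y

    orient′ : ∀ {n} (ax ay bx by cx cy : Polynomial n) → Polynomial n
    orient′ ax ay bx by cx cy = (bx :- ax) :* (cy :- ay) :- (by :- ay) :* (cx :- ax)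

    neg-pos : ∀ {x} → x < 0# → 0# < - x
    neg-pos {x} x<0 = <-respʳ-≈ (+-identityˡ _)
      (<-respˡ-≈ (-‿inverseʳ x) (+-monoˡ-< (- x) x<0))

    pos+nonneg : ∀ {x y} → 0# < x → 0# ≤ y → 0# < x + y
    pos+nonneg {x} {y} 0<x (inj₁ 0<y) = <-trans 0<y
      (<-respˡ-≈ (+-identityˡ y) (+-monoˡ-< y 0<x))
    pos+nonneg {x} {y} 0<x (inj₂ 0≈y) =
      <-respʳ-≈ (trans (sym (+-identityʳ x)) (+-congˡ 0≈y)) 0<x

    pos*nonneg : ∀ {x y} → 0# < x → 0# ≤ y → 0# ≤ x * y
    pos*nonneg 0<x (inj₁ 0<y) = inj₁ (*-pos 0<x 0<y)
    pos*nonneg {x} 0<x (inj₂ 0≈y) = inj₂ (trans (sym (zeroʳ x)) (*-congˡ 0≈y))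

    <⇒0<- : ∀ {x y} → x < y → 0# < y - x
    <⇒0<- {x} x<y = <-respˡ-≈ (-‿inverseʳ x) (+-monoˡ-< (- x) x<y)

    0<-⇒< : ∀ {x y} → 0# < y - x → x < y
    0<-⇒< {x} {y} 0<y-x = <-respʳ-≈
      (solve 2 (λ x y → (y :- x) :+ x := y) refl x y)
      (<-respˡ-≈ (+-identityˡ x) (+-monoˡ-< x 0<y-x))

    0<1 : 0# < 1#
    0<1 with compare 0# 1#
    ... | tri< 0<1 _ _ = 0<1
    ... | tri≈ _ 0≈1 _ = contradiction 0≈1 0≉1
    ... | tri> _ _ 1<0 = <-respʳ-≈ (solve 0 ((:- 𝟙) :* (:- 𝟙) := 𝟙) refl)
                           (*-pos (neg-pos 1<0) (neg-pos 1<0))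

    inverse-pos : ∀ {x y} → 0# < x → x * y ≈ 1# → 0# < y
    inverse-pos {x} {y} 0<x xy≈1 with compare 0# y
    ... | tri< 0<y _ _ = 0<y
    ... | tri≈ _ 0≈y _ = contradiction (trans (sym (zeroʳ x)) (trans (*-congˡ 0≈y) xy≈1)) 0≉1
    ... | tri> _ _ y<0 = contradiction
      (<-respʳ-≈ x*-y+1≈0 (pos+nonneg (*-pos 0<x (neg-pos y<0)) (inj₁ 0<1)))
      (irrefl refl)
      where
      x*-y+1≈0 : x * - y + 1# ≈ 0#
      x*-y+1≈0 = begin
        x * - y + 1#      ≈⟨ +-congˡ xy≈1 ⟨
        x * - y + x * y   ≈⟨ solve 2 (λ x y → x :* (:- y) :+ x :* y := con (ℤ.+ 0)) refl x y ⟩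
        0#                ∎

    o : Point F → Point F → Point F → Carrier
    o = orient F

    orient-cong : ∀ p q {x y} → _≈ₚ_ F x y → o p q x ≈ o p q y
    orient-cong p q (ex , ey) =
      +-cong (*-congˡ (+-congʳ ey)) (-‿cong (*-congˡ (+-congʳ ex)))

    orient-cyclic : ∀ p q r → o p q r ≈ o q r p
    orient-cyclic (px , py) (qx , qy) (rx , ry) =
      solve 6 (λ px py qx qy rx ry →
        orient′ px py qx qy rx ry := orient′ qx qy rx ry px py) refl px py qx qy rx ry

    orient-swap : ∀ p q r → - o p q r ≈ o p r q
    orient-swap (px , py) (qx , qy) (rx , ry) =
      solve 6 (λ px py qx qy rx ry →
        :- orient′ px py qx qy rx ry := orient′ px py rx ry qx qy) refl px py qx qy rx ry

    orient-first : ∀ p q → 0# ≈ o p q p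
    orient-first (px , py) (qx , qy) =
      solve 4 (λ px py qx qy → con (ℤ.+ 0) := orient′ px py qx qy px py) refl px py qx qy

    orient-lerp : ∀ t p q a b → o p q (lerp F t a b) ≈ (1# - t) * o p q a + t * o p q b
    orient-lerp t (px , py) (qx , qy) (ax , ay) (bx , by) =
      solve 9 (λ t px py qx qy ax ay bx by →
        orient′ px py qx qy (lerp′ t ax bx) (lerp′ t ay by) :=
        lerp′ t (orient′ px py qx qy ax ay) (orient′ px py qx qy bx by))
      refl t px py qx qy ax ay bx by

    orient-self : ∀ t p q → o p q (lerp F t p q) ≈ 0#
    orient-self t (px , py) (qx , qy) =
      solve 5 (λ t px py qx qy →
        orient′ px py qx qy (lerp′ t px qx) (lerp′ t py qy) := con (ℤ.+ 0))
      refl t px py qx qy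

    -- If a and b are weakly on one side of the line pq and not both on it,
    -- the open segment ab misses that line.

    OneSided : Carrier → Carrier → Set (ℓ₁ ⊔ ℓ₂)
    OneSided u w = (0# < u × 0# ≤ w) ⊎ (0# ≤ u × 0# < w)

    mix-pos : ∀ {t u w} → 0# < t → t < 1# → OneSided u w → 0# < (1# - t) * u + t * w
    mix-pos 0<t t<1 (inj₁ (0<u , 0≤w)) =
      pos+nonneg (*-pos (<⇒0<- t<1) 0<u) (pos*nonneg 0<t 0≤w)
    mix-pos 0<t t<1 (inj₂ (0≤u , 0<w)) =
      <-respʳ-≈ (+-comm _ _) (pos+nonneg (*-pos 0<t 0<w) (pos*nonneg (<⇒0<- t<1) 0≤u))

    misses⁺ : ∀ p q a b → OneSided (o p q a) (o p q b) → ¬ MeetsInterior F p q a b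
    misses⁺ p q a b side (z , (t , _ , _ , z≈pq) , (s , 0<s , s<1 , z≈ab)) =
      irrefl refl (<-respʳ-≈ lies-on-line (mix-pos 0<s s<1 side))
      where
      lies-on-line : (1# - s) * o p q a + s * o p q b ≈ 0#
      lies-on-line = begin
        (1# - s) * o p q a + s * o p q b   ≈⟨ orient-lerp s p q a b ⟨
        o p q (lerp F s a b)               ≈⟨ orient-cong p q z≈ab ⟨
        o p q z                            ≈⟨ orient-cong p q z≈pq ⟩
        o p q (lerp F t p q)               ≈⟨ orient-self t p q ⟩
        0#                                 ∎

    misses⁻ : ∀ p q a b → OneSided (- o p q a) (- o p q b) → ¬ MeetsInterior F p q a b
    misses⁻ p q a b side (z , (t , _ , _ , z≈pq) , (s , 0<s , s<1 , z≈ab)) =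
      irrefl refl (<-respʳ-≈ lies-on-line (mix-pos 0<s s<1 side))
      where
      lies-on-line : (1# - s) * - o p q a + s * - o p q b ≈ 0#
      lies-on-line = begin
        (1# - s) * - o p q a + s * - o p q b
          ≈⟨ solve 3 (λ s u w → (𝟙 :- s) :* (:- u) :+ s :* (:- w) := :- lerp′ s u w) refl s _ _ ⟩
        - ((1# - s) * o p q a + s * o p q b)   ≈⟨ -‿cong (orient-lerp s p q a b) ⟨
        - o p q (lerp F s a b)                 ≈⟨ -‿cong (orient-cong p q z≈ab) ⟨
        - o p q z                              ≈⟨ -‿cong (orient-cong p q z≈pq) ⟩
        - o p q (lerp F t p q)                 ≈⟨ -‿cong (orient-self t p q) ⟩
        - 0#                                   ≈⟨ -0#≈0# ⟩
        0#                                     ∎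

    -- Two segments, each separated by the line through the other, cross; the
    -- parameters t and s of the crossing point come from Cramer's rule.
    crosses : ∀ p q a b → 0# < o p q a → 0# < - o p q b → 0# < o a b q → 0# < - o a b p →
              MeetsInterior F p q a b
    crosses p@(px , py) q@(qx , qy) a@(ax , ay) b@(bx , by) 0<A 0<B 0<Q 0<P =
      lerp F t p q , (t , inj₁ 0<t , inj₁ t<1 , refl , refl)
                   , (s , 0<s , s<1 , meet px qx ax bx identity-x , meet py qy ay by identity-y)
      where
      A P Q D : Carrier
      A = o p q a
      P = - o a b p
      Q = o a b q
      D = P + Q

      0<D : 0# < D
      0<D = pos+nonneg 0<P (inj₁ 0<Q)

      inv : ∃ λ w → D * w ≈ 1#
      inv = inverse D λ D≈0 → irrefl (sym D≈0) 0<D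

      w t s : Carrier
      w = proj₁ inv
      t = P * w
      s = A * w

      Dw≈1 : D * w ≈ 1#
      Dw≈1 = proj₂ inv

      0<w : 0# < w
      0<w = inverse-pos 0<D Dw≈1

      D≈A-b : D ≈ A - o p q b
      D≈A-b = solve 8 (λ px py qx qy ax ay bx by →
        (:- orient′ ax ay bx by px py) :+ orient′ ax ay bx by qx qy :=
        orient′ px py qx qy ax ay :+ (:- orient′ px py qx qy bx by))
        refl px py qx qy ax ay bx by

      complement : ∀ {x y} → D ≈ x + y → y * w ≈ 1# - x * w
      complement {x} {y} D≈x+y = begin
        y * w                   ≈⟨ solve 3 (λ x y w → y :* w := (x :+ y) :* w :- x :* w) refl x y w ⟩
        (x + y) * w - x * w     ≈⟨ +-congʳ (*-congʳ D≈x+y) ⟨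
        D * w - x * w           ≈⟨ +-congʳ Dw≈1 ⟩
        1# - x * w              ∎

      0<t : 0# < t
      0<t = *-pos 0<P 0<w

      t<1 : t < 1#
      t<1 = 0<-⇒< (<-respʳ-≈ (complement refl) (*-pos 0<Q 0<w))

      0<s : 0# < s
      0<s = *-pos 0<A 0<w

      s<1 : s < 1#
      s<1 = 0<-⇒< (<-respʳ-≈ (complement D≈A-b) (*-pos 0<B 0<w))

      identity-x : D * px + P * (qx - px) ≈ D * ax + A * (bx - ax)
      identity-x = solve 8 (λ px py qx qy ax ay bx by →
        let P′ = :- orient′ ax ay bx by px py
            D′ = P′ :+ orient′ ax ay bx by qx qy
            A′ = orient′ px py qx qy ax ay
        in D′ :* px :+ P′ :* (qx :- px) := D′ :* ax :+ A′ :* (bx :- ax))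
        refl px py qx qy ax ay bx by

      identity-y : D * py + P * (qy - py) ≈ D * ay + A * (by - ay)
      identity-y = solve 8 (λ px py qx qy ax ay bx by →
        let P′ = :- orient′ ax ay bx by px py
            D′ = P′ :+ orient′ ax ay bx by qx qy
            A′ = orient′ px py qx qy ax ay
        in D′ :* py :+ P′ :* (qy :- py) := D′ :* ay :+ A′ :* (by :- ay))
        refl px py qx qy ax ay bx by

      scale : ∀ u x y → (1# - u * w) * x + u * w * y ≈ w * (D * x + u * (y - x))
      scale u x y = begin
        (1# - u * w) * x + u * w * y
          ≈⟨ +-congʳ (*-congʳ (+-congʳ Dw≈1)) ⟨
        (D * w - u * w) * x + u * w * y
          ≈⟨ solve 5 (λ D w u x y → (D :* w :- u :* w) :* x :+ u :* w :* y :=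
                                    w :* (D :* x :+ u :* (y :- x))) refl D w u x y ⟩
        w * (D * x + u * (y - x))  ∎

      meet : ∀ pz qz az bz → D * pz + P * (qz - pz) ≈ D * az + A * (bz - az) →
             (1# - t) * pz + t * qz ≈ (1# - s) * az + s * bz
      meet pz qz az bz eq = trans (scale P pz qz) (trans (*-congˡ eq) (sym (scale A az bz)))

  module _ {m : ℕ} (S : ConvexPointSet F m) where
    open ConvexPointSet S

    private
      left : ∀ {x k n} → x Fin.< k → k Fin.< n → 0# < o (pt k) (pt n) (pt x)
      left x<k k<n = <-respʳ-≈ (orient-cyclic _ _ _) (ccw x<k k<n)

      right : ∀ {k x n} → k Fin.< x → x Fin.< n → 0# < - o (pt k) (pt n) (pt x)
      right k<x x<n = <-respʳ-≈ (sym (orient-swap _ _ _)) (ccw k<x x<n)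

      first⁻ : ∀ {k n} → 0# ≈ - o (pt k) (pt n) (pt k)
      first⁻ = trans (sym -0#≈0#) (-‿cong (orient-first _ _))

    meetsInterior? : ∀ {k n a b} → k Fin.< n → b Fin.< n → a Fin.< b →
                     Dec (MeetsInterior F (pt k) (pt n) (pt a) (pt b))
    meetsInterior? {k} {n} {a} {b} k<n b<n a<b with Fin.<-cmp a k | Fin.<-cmp k b
    ... | tri< a<k _ _    | tri< k<b _ _    =
          yes (crosses _ _ _ _ (left a<k k<n) (right k<b b<n) (ccw a<b b<n) (right a<k k<b))
    ... | tri< a<k _ _    | tri≈ _ ≡.refl _ =
          no (misses⁺ _ _ _ _ (inj₁ (left a<k k<n , inj₂ (orient-first _ _))))
    ... | tri< a<k _ _    | tri> _ _ b<k    =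
          no (misses⁺ _ _ _ _ (inj₁ (left a<k k<n , inj₁ (left b<k k<n))))
    ... | tri≈ _ ≡.refl _ | _               =
          no (misses⁻ _ _ _ _ (inj₂ (inj₂ first⁻ , right a<b b<n)))
    ... | tri> _ _ k<a    | _               =
          no (misses⁻ _ _ _ _ (inj₁ ( right k<a (ℕ.<-trans a<b b<n)
                                    , inj₁ (right (ℕ.<-trans k<a a<b) b<n))))

module _ {c ℓ₁ ℓ₂ : Level} (F : OrderedField c ℓ₁ ℓ₂)
         {i : ℕ} (S : ConvexPointSet F (suc i)) where
  open ConvexPointSet S

  -- The first i points carry the drawing; the last one is the additional
  -- vertex, which lies between the root and the first point.

  vertex : Fin i → Point F
  vertex k = pt (inject₁ k)

  extra : Point F
  extra = pt (fromℕ i)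

  module _ (π : BlockMap i) where

    Visible : Point F → Point F → Set (c ⊔ ℓ₁ ⊔ ℓ₂)
    Visible p q = ∀ a b → IsEdge π a b → ¬ MeetsInterior F p q (vertex a) (vertex b)

    visible? : ∀ k → Dec (Visible (vertex k) extra)
    visible? k = Fin.all? λ a → Fin.all? λ b → unblocked? a b
      where
      inject₁<fromℕ : ∀ x → inject₁ x Fin.< fromℕ i
      inject₁<fromℕ x =
        ≡.subst₂ ℕ._<_ (≡.sym (Fin.toℕ-inject₁ x)) (≡.sym (Fin.toℕ-fromℕ i)) (Fin.toℕ<n x)

      inject₁-mono : ∀ {x y : Fin i} → x Fin.< y → inject₁ x Fin.< inject₁ y
      inject₁-mono = ≡.subst₂ ℕ._<_ (≡.sym (Fin.toℕ-inject₁ _)) (≡.sym (Fin.toℕ-inject₁ _))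

      unblocked? : ∀ a b → Dec (IsEdge π a b → ¬ MeetsInterior F (vertex k) extra (vertex a) (vertex b))
      unblocked? a b with isEdge? π a b
      ... | no ¬edge = yes λ edge → contradiction edge ¬edge
      ... | yes edge@(a<b , _) = map′ (λ ¬meets _ → ¬meets) (λ f → f edge)
              (¬? (meetsInterior? F S (inject₁<fromℕ k) (inject₁<fromℕ b) (inject₁-mono a<b)))

    isolationDegree : ℕ
    isolationDegree = length (filter (λ k → isolated? π k ×-dec visible? k) (allFin i))

vectors : ∀ {a} {A : Set a} → List A → (n : ℕ) → List (Vec A n)
vectors xs zero    = [ [] ]
vectors xs (suc n) = cartesianProductWith _∷_ xs (vectors xs n)

blockMaps : ∀ i → List (BlockMap i)
blockMaps i = vectors (vectors (outside ∷ inside ∷ []) i) i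

-- Indices start at zero: entry j counts the partitions of isolation degree j.
degreeVector : ∀ {c ℓ₁ ℓ₂} (F : OrderedField c ℓ₁ ℓ₂) (n : ℕ) {i : ℕ} →
               ConvexPointSet F (suc i) → Vector ℕ n
degreeVector F n {i} S j =
  length (filter (λ π → isNCPartition? π ×-dec isolationDegree F S π ℕ.≟ toℕ j) (blockMaps i))

B : ∀ n → Fin n → Fin n → ℕ
B n p q with Fin.<-cmp p q
... | tri< _ _ _ = 2 ℕ.^ (toℕ q ℕ.∸ toℕ p ℕ.∸ 1)
... | tri≈ _ _ _ = 0
... | tri> _ _ _ = if ⌊ toℕ p ℕ.≟ suc (toℕ q) ⌋ then 1 else 0

infixr 7 _*ᵥ_
_*ᵥ_ : ∀ {m n} → (Fin m → Fin n → ℕ) → Vector ℕ n → Vector ℕ m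
(A *ᵥ v) p = sum (λ q → A p q ℕ.* v q)

{-# OPTIONS --safe #-}

-- A segment from the additional vertex to k meets exactly the edges ab with
-- a < k < b, so the isolation degree counts the singletons that lie under no
-- block.  Breaking the block of the last vertex i + 1 of a non-crossing
-- partition into singletons gives a non-crossing partition of [i] in which the
-- other vertices of that block are visible isolated vertices; conversely i + 1
-- may be joined to any set s of visible isolated vertices.  If s is empty, the
-- degree q becomes q + 1; otherwise only the visible isolated vertices before
-- the first element of s survive, and 2 ^ (q - p - 1) sets s leave exactly p.

module Submission where

open import Defs
open import Level using (Level)
open import Data.Bool.Base using (Bool; true; false; if_then_else_)
open import Data.Bool.Properties using (T-≡)
open import Data.Fin.Base as Fin using (Fin; zero; suc; toℕ; inject₁; fromℕ)
import Data.Fin.Properties as Fin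
open import Data.Fin.Relation.Unary.Top using (view; ‵fromℕ; ‵inject₁)
open import Data.Fin.Subset
  using (Subset; inside; outside; ⊥; ⁅_⁆; _∈_; _∉_; _⊆_; ∣_∣; Nonempty; Empty)
open import Data.Fin.Subset.Properties
  using ( drop-there; drop-∷-⊆; out⊆; in⊆in; drop-∷-Empty; Empty-unique; ∉⊥; ∣⊥∣≡0; ∣p∣≤n; ⊆-antisym
        ; nonempty?; x∈⁅x⁆; x∈⁅y⁆⇒x≡y; _∈?_; _⊆?_)
open import Data.List.Base as List using (List; []; _∷_; filter; length; map; _++_; cartesianProduct)
import Data.List.Properties as List
import Data.List.Membership.Propositional as List
open import Data.List.Membership.Propositional.Properties
  using (∈-map⁺; ∈-map⁻; ∈-filter⁺; ∈-filter⁻; ∈-cartesianProductWith⁺; ∈-cartesianProduct⁺)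
open import Data.List.Membership.Propositional.Properties.WithK using (unique∧set⇒bag)
open import Data.List.Relation.Binary.BagAndSetEquality using (∼bag⇒↭)
open import Data.List.Relation.Binary.Permutation.Propositional.Properties using (↭-length)
import Data.List.Relation.Unary.All as All
import Data.List.Relation.Unary.All.Properties as All
open import Data.List.Relation.Unary.AllPairs using ([]; _∷_)
open import Data.List.Relation.Unary.Any using (here; there)
open import Data.List.Relation.Unary.Unique.Propositional using (Unique)
import Data.List.Relation.Unary.Unique.Propositional.Properties as Unique
open import Data.Nat.Base as ℕ using (ℕ; zero; suc; _+_; _*_; _^_; _∸_; _≤_; _<_; z≤n; s≤s)
import Data.Nat.Properties as ℕ
open import Data.Product.Base as Product using (∃; ∃₂; _×_; _,_; proj₁; proj₂; uncurry)
open import Data.Sum.Base using (_⊎_; inj₁; inj₂)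
open import Data.Vec.Base using (Vec; []; _∷_; _∷ʳ_; here; there; init; lookup; tabulate)
import Data.Vec.Properties as Vec
open import Function.Base using (_∘_; id)
open import Function.Bundles using (_⇔_; mk⇔; Equivalence)
open Equivalence using (to; from)
open import Relation.Binary.Definitions using (tri<; tri≈; tri>)
open import Relation.Binary.PropositionalEquality
  using (_≡_; _≢_; refl; sym; trans; cong; cong₂; subst; subst₂; module ≡-Reasoning)
open import Relation.Nullary.Decidable
  using (yes; no; does; ⌊_⌋; _×-dec_; _→-dec_; ¬?; True; toWitness; fromWitness)
open import Relation.Nullary.Negation using (¬_; contradiction)
open import Relation.Unary using (Pred; Decidable)
open import Algebra.Properties.Semiring.Sum ℕ.+-*-semiring
  using (sum; sum-cong-≗; ∑-distrib-+; sum-replicate-zero)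

-- Counting list entries by a decidable predicate.

module _ {a p} {A : Set a} {P : Pred A p} (P? : Decidable P) where

  count : List A → ℕ
  count xs = length (filter P? xs)

  count-∷ : ∀ x xs → count (x ∷ xs) ≡ (if does (P? x) then 1 else 0) + count xs
  count-∷ x xs with does (P? x)
  ... | true  = refl
  ... | false = refl

  count-++ : ∀ xs ys → count (xs ++ ys) ≡ count xs + count ys
  count-++ xs ys = trans (cong length (List.filter-++ P? xs ys)) (List.length-++ (filter P? xs))

  count-none : ∀ xs → (∀ x → ¬ P x) → count xs ≡ 0
  count-none xs ¬P = cong length (List.filter-none P? (All.universal ¬P xs))

  count-map : ∀ {b} {B : Set b} (f : B → A) xs → count (map f xs) ≡ length (filter (P? ∘ f) xs)
  count-map f []       = refl
  count-map f (x ∷ xs) with does (P? (f x))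
  ... | true  = cong suc (count-map f xs)
  ... | false = count-map f xs

  count-⇔ : ∀ {q} {Q : Pred A q} (Q? : Decidable Q) xs → (∀ x → P x ⇔ Q x) →
            count xs ≡ length (filter Q? xs)
  count-⇔ Q? xs P⇔Q = cong length
    (List.filter-≐ P? Q? ((λ {x} → to (P⇔Q x)) , (λ {x} → from (P⇔Q x))) xs)

  -- With `f = id` the list is `allFin n`, which turns the isolation degree into the size of a
  -- subset. General `f` is needed for the induction, since the tail of the list is tabulated from
  -- `f ∘ suc`.
  count-tabulate : ∀ {n} (f : Fin n → A) (s : Subset n) → (∀ k → P (f k) ⇔ k ∈ s) →
                   count (List.tabulate f) ≡ ∣ s ∣
  count-tabulate f []      P⇔∈ = refl
  count-tabulate f (b ∷ s) P⇔∈
    with ih ← count-tabulate (f ∘ suc) s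
                (λ k → mk⇔ (drop-there ∘ to (P⇔∈ (suc k))) (from (P⇔∈ (suc k)) ∘ there))
    with b | P? (f zero)
  ... | true  | yes _ = cong suc ih
  ... | false | no _  = ih
  ... | true  | no ¬P = contradiction (from (P⇔∈ zero) here) ¬P
  ... | false | yes p with () ← to (P⇔∈ zero) p

-- Injectivity is required only on members of the list, because `extend` is injective only on pairs
-- whose set consists of visible isolated vertices.
map-unique : ∀ {a b} {A : Set a} {B : Set b} (f : A → B) {xs} → Unique xs →
             (∀ {x y} → x List.∈ xs → y List.∈ xs → f x ≡ f y → x ≡ y) → Unique (map f xs)
map-unique f []       inj = []
map-unique f (x∉ ∷ u) inj =
  All.map⁺ (All.tabulate λ y∈ fx≡fy → All.lookup x∉ y∈ (inj (here refl) (there y∈) fx≡fy))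
  ∷ map-unique f u (λ x∈ y∈ → inj (there x∈) (there y∈))

module _ {a b p q} {A : Set a} {B : Set b} {P : Pred A p} {Q : Pred B q} where

  -- The image under `f` of the filtered `xs` and the filtered `ys` are duplicate-free lists with
  -- the same members, hence permutations of each other.
  count-bijection : (P? : Decidable P) (Q? : Decidable Q) {xs : List A} {ys : List B} →
    Unique xs → (∀ x → x List.∈ xs) → Unique ys → (∀ y → y List.∈ ys) →
    (f : A → B) → (∀ x → P x → Q (f x)) →
    (∀ {x x′} → P x → P x′ → f x ≡ f x′ → x ≡ x′) →
    (∀ y → Q y → ∃ λ x → P x × f x ≡ y) →
    count P? xs ≡ count Q? ys
  count-bijection P? Q? {xs} {ys} xs! ∈xs ys! ∈ys f f-pres f-inj f-surj = begin
    count P? xs                   ≡⟨ List.length-map f (filter P? xs) ⟨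
    length (map f (filter P? xs)) ≡⟨ ↭-length (∼bag⇒↭ (unique∧set⇒bag
                                       (map-unique f (Unique.filter⁺ P? xs!) λ x∈ y∈ →
                                         f-inj (proj₂ (∈-filter⁻ P? {xs = xs} x∈))
                                               (proj₂ (∈-filter⁻ P? {xs = xs} y∈)))
                                       (Unique.filter⁺ Q? ys!)
                                       (mk⇔ image⊆ ⊆image))) ⟩
    count Q? ys                   ∎
    where
    open ≡-Reasoning
    image⊆ : ∀ {y} → y List.∈ map f (filter P? xs) → y List.∈ filter Q? ys
    image⊆ y∈ with x , x∈ , refl ← ∈-map⁻ f y∈ =
      ∈-filter⁺ Q? (∈ys (f x)) (f-pres x (proj₂ (∈-filter⁻ P? {xs = xs} x∈)))
    ⊆image : ∀ {y} → y List.∈ filter Q? ys → y List.∈ map f (filter P? xs)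
    ⊆image {y} y∈ with x , px , refl ← f-surj y (proj₂ (∈-filter⁻ Q? {xs = ys} y∈)) =
      ∈-map⁺ f (∈-filter⁺ P? (∈xs x) px)

-- Counting pairs by grouping them according to the degree of the first component.

sum-*-0 : ∀ {n} (f : Fin n → ℕ) → sum {n} (λ q → f q * 0) ≡ 0
sum-*-0 {n} f = trans (sum-cong-≗ {n} (ℕ.*-zeroʳ ∘ f)) (sum-replicate-zero n)

sum-indicator : ∀ (g : ℕ → ℕ) {m n} → m < n →
  sum {n} (λ q → g (toℕ q) * (if does (m ℕ.≟ toℕ q) then 1 else 0)) ≡ g m
sum-indicator g {zero} {suc n} _ = begin
  g 0 * 1 + sum {n} (λ q → g (suc (toℕ q)) * 0)
    ≡⟨ cong₂ _+_ (ℕ.*-identityʳ (g 0)) (sum-*-0 {n} (g ∘ suc ∘ toℕ)) ⟩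
  g 0 + 0  ≡⟨ ℕ.+-identityʳ (g 0) ⟩
  g 0      ∎
  where open ≡-Reasoning
sum-indicator g {suc m} {suc n} (s≤s m<n) =
  cong₂ _+_ (ℕ.*-zeroʳ (g 0)) (sum-indicator (g ∘ suc) m<n)

module _ {a b p r} {A : Set a} {B : Set b} {P : Pred A p} {R : Pred (A × B) r}
         (P? : Decidable P) (R? : Decidable R) (ys : List B)
         (d : A → ℕ) (g : ℕ → ℕ) {n : ℕ}
         (d<n : ∀ x → P x → d x < n)
         (R⇒P : ∀ x y → R (x , y) → P x)
         (fibre : ∀ x → P x → count (λ y → R? (x , y)) ys ≡ g (d x)) where

  private
    level? : (q : Fin n) → Decidable (λ x → P x × d x ≡ toℕ q)
    level? q x = P? x ×-dec d x ℕ.≟ toℕ q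

    -- If `P x` holds, only the summand at `q = d x` survives, and `d<n` keeps that index in range;
    -- if it fails, both sides vanish.
    fibre-indicator : ∀ x → count (λ y → R? (x , y)) ys ≡
      sum {n} (λ q → g (toℕ q) * (if does (level? q x) then 1 else 0))
    fibre-indicator x with P? x
    ... | yes px = trans (fibre x px) (sym (sum-indicator g (d<n x px)))
    ... | no ¬px = trans (count-none (λ y → R? (x , y)) ys (λ y → ¬px ∘ R⇒P x y))
                     (sym (sum-*-0 {n} (g ∘ toℕ)))

  count-cartesianProduct : ∀ xs →
    count R? (cartesianProduct xs ys) ≡ sum {n} (λ q → g (toℕ q) * count (level? q) xs)
  count-cartesianProduct [] = sym (sum-*-0 {n} (g ∘ toℕ))
  count-cartesianProduct (x ∷ xs) = begin
    count R? (map (x ,_) ys ++ cartesianProduct xs ys)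
      ≡⟨ count-++ R? (map (x ,_) ys) _ ⟩
    count R? (map (x ,_) ys) + count R? (cartesianProduct xs ys)
      ≡⟨ cong₂ _+_ (trans (count-map R? (x ,_) ys) (fibre-indicator x)) (count-cartesianProduct xs) ⟩
    sum {n} (λ q → g (toℕ q) * (if does (level? q x) then 1 else 0))
      + sum {n} (λ q → g (toℕ q) * count (level? q) xs)
      ≡⟨ ∑-distrib-+ {n} _ _ ⟨
    sum {n} (λ q → g (toℕ q) * (if does (level? q x) then 1 else 0) + g (toℕ q) * count (level? q) xs)
      ≡⟨ sum-cong-≗ {n} (λ q → trans (sym (ℕ.*-distribˡ-+ (g (toℕ q)) _ _))
                                 (cong (g (toℕ q) *_) (sym (count-∷ (level? q) x xs)))) ⟩
    sum {n} (λ q → g (toℕ q) * count (level? q) (x ∷ xs))  ∎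
    where open ≡-Reasoning

-- Enumerations of vectors and subsets.

module _ {a} {A : Set a} {xs : List A} where

  ∈-vectors : (∀ x → x List.∈ xs) → ∀ {n} (v : Vec A n) → v List.∈ vectors xs n
  ∈-vectors ∈xs []      = here refl
  ∈-vectors ∈xs (x ∷ v) = ∈-cartesianProductWith⁺ _∷_ (∈xs x) (∈-vectors ∈xs v)

  vectors-unique : Unique xs → ∀ n → Unique (vectors xs n)
  vectors-unique xs! zero    = All.[] ∷ []
  vectors-unique xs! (suc n) = Unique.cartesianProductWith⁺ _∷_ Vec.∷-injective xs! (vectors-unique xs! n)

subsets : ∀ n → List (Subset n)
subsets = vectors (outside ∷ inside ∷ [])

∈-subsets : ∀ {n} (s : Subset n) → s List.∈ subsets n
∈-subsets = ∈-vectors λ { false → here refl ; true → there (here refl) }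

subsets-unique : ∀ n → Unique (subsets n)
subsets-unique = vectors-unique (((λ ()) All.∷ All.[]) ∷ (All.[] ∷ []))

count-subsets : ∀ {p n} {P : Pred (Subset (suc n)) p} (P? : Decidable P) →
  count P? (subsets (suc n)) ≡ count (P? ∘ (outside ∷_)) (subsets n) + count (P? ∘ (inside ∷_)) (subsets n)
count-subsets {n = n} P? = begin
  -- `cartesianProductWith` over a two-element list of heads unfolds to two maps and a trailing
  -- empty list.
  count P? (map (outside ∷_) L ++ map (inside ∷_) L ++ [])
    ≡⟨ cong (λ z → count P? (map (outside ∷_) L ++ z)) (List.++-identityʳ (map (inside ∷_) L)) ⟩
  count P? (map (outside ∷_) L ++ map (inside ∷_) L)
    ≡⟨ count-++ P? (map (outside ∷_) L) _ ⟩
  count P? (map (outside ∷_) L) + count P? (map (inside ∷_) L)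
    ≡⟨ cong₂ _+_ (count-map P? (outside ∷_) L) (count-map P? (inside ∷_) L) ⟩
  count (P? ∘ (outside ∷_)) L + count (P? ∘ (inside ∷_)) L ∎
  where
  open ≡-Reasoning
  L = subsets n

-- Counting the sets to join by the number of vertices that remain visible.

outside∷-⊆⇔ : ∀ {n b} (v s : Subset n) → (outside ∷ s ⊆ b ∷ v) ⇔ (s ⊆ v)
outside∷-⊆⇔ v s = mk⇔ drop-∷-⊆ out⊆

inside∷-⊆⇔ : ∀ {n} (v s : Subset n) → (inside ∷ s ⊆ inside ∷ v) ⇔ (s ⊆ v)
inside∷-⊆⇔ v s = mk⇔ drop-∷-⊆ in⊆in

inside∷⊈outside∷ : ∀ {n} (v s : Subset n) → ¬ (inside ∷ s ⊆ outside ∷ v)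
inside∷⊈outside∷ v s s⊆v with () ← s⊆v here

count-⊆ : ∀ {n} (v : Subset n) → count (_⊆? v) (subsets n) ≡ 2 ^ ∣ v ∣
count-⊆ []                = refl
count-⊆ (outside ∷ v) = begin
  count (_⊆? (outside ∷ v)) (subsets _) ≡⟨ count-subsets (_⊆? (outside ∷ v)) ⟩
  _ ≡⟨ cong₂ _+_
         (trans (count-⇔ _ (_⊆? v) (subsets _) (outside∷-⊆⇔ v)) (count-⊆ v))
         (count-none _ (subsets _) (inside∷⊈outside∷ v)) ⟩
  2 ^ ∣ v ∣ + 0 ≡⟨ ℕ.+-identityʳ _ ⟩
  2 ^ ∣ v ∣ ∎
  where open ≡-Reasoning
count-⊆ (inside ∷ v) = begin
  count (_⊆? (inside ∷ v)) (subsets _) ≡⟨ count-subsets (_⊆? (inside ∷ v)) ⟩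
  _ ≡⟨ cong₂ _+_
         (trans (count-⇔ _ (_⊆? v) (subsets _) (outside∷-⊆⇔ v)) (count-⊆ v))
         (trans (count-⇔ _ (_⊆? v) (subsets _) (inside∷-⊆⇔ v)) (count-⊆ v)) ⟩
  2 ^ ∣ v ∣ + 2 ^ ∣ v ∣ ≡⟨ cong (2 ^ ∣ v ∣ +_) (ℕ.+-identityʳ _) ⟨
  2 ^ ∣ inside ∷ v ∣ ∎
  where open ≡-Reasoning

-- The isolated vertices still visible once a new last vertex is joined to the
-- subset s of the visible isolated vertices v: those before the first element
-- of s, together with the new vertex if s is empty.
remaining : ∀ {n} → Subset n → Subset n → Subset (suc n)
remaining []      []            = inside ∷ []
remaining (b ∷ v) (inside ∷ s)  = ⊥
remaining (b ∷ v) (outside ∷ s) = b ∷ remaining v s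

inject₁∈remaining⁺ : ∀ {n} {k : Fin n} (v s : Subset n) → k ∈ v → (∀ l → l ∈ s → k Fin.< l) →
                     inject₁ k ∈ remaining v s
inject₁∈remaining⁺ {k = zero} (b ∷ v) (inside ∷ s) k∈v k< = contradiction (k< zero here) (ℕ.<-irrefl refl)
inject₁∈remaining⁺ {k = suc k} (b ∷ v) (inside ∷ s) k∈v k< = contradiction (k< zero here) λ ()
inject₁∈remaining⁺ (b ∷ v) (outside ∷ s) here k< = here
inject₁∈remaining⁺ (b ∷ v) (outside ∷ s) (there k∈v) k< =
  there (inject₁∈remaining⁺ v s k∈v λ l l∈s → ℕ.s<s⁻¹ (k< (suc l) (there l∈s)))

inject₁∈remaining⁻ : ∀ {n} {k : Fin n} (v s : Subset n) → inject₁ k ∈ remaining v s →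
                     k ∈ v × (∀ l → l ∈ s → k Fin.< l)
inject₁∈remaining⁻ (b ∷ v) (inside ∷ s) k∈ = contradiction k∈ ∉⊥
inject₁∈remaining⁻ {k = zero} (b ∷ v) (outside ∷ s) here = here , λ { (suc l) _ → s≤s z≤n }
inject₁∈remaining⁻ {k = suc k} (b ∷ v) (outside ∷ s) (there k∈) =
  there (proj₁ ih) , λ { (suc l) (there l∈s) → s≤s (proj₂ ih l l∈s) }
  where ih = inject₁∈remaining⁻ v s k∈

fromℕ∈remaining⇔ : ∀ {n} (v s : Subset n) → fromℕ n ∈ remaining v s ⇔ Empty s
fromℕ∈remaining⇔ []      []            = mk⇔ (λ _ ()) (λ _ → here)
fromℕ∈remaining⇔ (b ∷ v) (inside ∷ s)  =
  mk⇔ (λ n∈ → contradiction n∈ ∉⊥) (λ ∅ → contradiction (zero , here) ∅)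
fromℕ∈remaining⇔ (b ∷ v) (outside ∷ s) = mk⇔
  (λ { (there n∈) (suc l , there l∈s) → to ih n∈ (l , l∈s) })
  (there ∘ from ih ∘ drop-∷-Empty)
  where ih = fromℕ∈remaining⇔ v s

-- The entries of `B` on natural-number indices. They are constant along diagonals, so both indices
-- can be lowered together, which is the recursion that `count-remaining` follows.
weight : ℕ → ℕ → ℕ
weight zero    zero    = 0
weight zero    (suc q) = 2 ^ q
weight (suc p) (suc q) = weight p q
weight (suc zero)    zero = 1
weight (suc (suc _)) zero = 0

weight-< : ∀ {p q} → p < q → weight p q ≡ 2 ^ (q ∸ p ∸ 1)
weight-< {zero}  {suc q} _         = refl
weight-< {suc p} {suc q} (s≤s p<q) = weight-< p<q

weight-diagonal : ∀ p → weight p p ≡ 0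
weight-diagonal zero    = refl
weight-diagonal (suc p) = weight-diagonal p

weight-subdiagonal : ∀ q → weight (suc q) q ≡ 1
weight-subdiagonal zero    = refl
weight-subdiagonal (suc q) = weight-subdiagonal q

weight-> : ∀ {p q} → q < p → p ≢ suc q → weight p q ≡ 0
weight-> {suc zero}    {zero}  _         p≢ = contradiction refl p≢
weight-> {suc (suc p)} {zero}  _         p≢ = refl
weight-> {suc p}       {suc q} (s≤s q<p) p≢ = weight-> q<p (p≢ ∘ cong suc)

B≡weight : ∀ n (p q : Fin n) → B n p q ≡ weight (toℕ p) (toℕ q)
B≡weight n p q with Fin.<-cmp p q
... | tri< p<q _ _    = sym (weight-< p<q)
... | tri≈ _ refl _   = sym (weight-diagonal (toℕ p))
... | tri> _ _ q<p with toℕ p ℕ.≟ suc (toℕ q)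
...   | yes p≡1+q = sym (trans (cong (λ z → weight z (toℕ q)) p≡1+q) (weight-subdiagonal (toℕ q)))
...   | no  p≢1+q = sym (weight-> q<p p≢1+q)

remaining? : ∀ {n} (v : Subset n) j → Decidable (λ s → s ⊆ v × ∣ remaining v s ∣ ≡ j)
remaining? v j s = s ⊆? v ×-dec ∣ remaining v s ∣ ℕ.≟ j

-- Induction along the vertices. One outside `v` can neither be joined nor be counted. For one in
-- `v`, leaving it unjoined keeps it visible and lowers the target `j` by one, while joining it
-- hides everything after it, so that the rest of `s` is an arbitrary subset of `v` and nothing
-- remains.
count-remaining : ∀ {n} (v : Subset n) j → count (remaining? v j) (subsets n) ≡ weight j ∣ v ∣
-- With no old vertices left, exactly the new vertex remains, so only `j = 1` is attained.
count-remaining [] zero          = refl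
count-remaining [] (suc zero)    = refl
count-remaining [] (suc (suc j)) = refl
count-remaining {suc n} (outside ∷ v) j = begin
  count (remaining? (outside ∷ v) j) (subsets (suc n)) ≡⟨ count-subsets (remaining? (outside ∷ v) j) ⟩
  _ ≡⟨ cong₂ _+_
         (trans (count-⇔ _ (remaining? v j) (subsets n) λ s →
                   mk⇔ (Product.map₁ (to (outside∷-⊆⇔ v s))) (Product.map₁ (from (outside∷-⊆⇔ v s))))
                (count-remaining v j))
         (count-none _ (subsets n) λ s → inside∷⊈outside∷ v s ∘ proj₁) ⟩
  weight j ∣ v ∣ + 0 ≡⟨ ℕ.+-identityʳ _ ⟩
  weight j ∣ v ∣     ∎
  where open ≡-Reasoning
count-remaining {suc n} (inside ∷ v) zero = begin
  count (remaining? (inside ∷ v) zero) (subsets (suc n)) ≡⟨ count-subsets (remaining? (inside ∷ v) zero) ⟩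
  _ ≡⟨ cong₂ _+_
         -- An unjoined visible vertex remains, so the target 0 forces joining it.
         (count-none _ (subsets n) λ { s (_ , ()) })
         (trans (count-⇔ _ (_⊆? v) (subsets n) λ s →
                   mk⇔ (to (inside∷-⊆⇔ v s) ∘ proj₁)
                       (λ s⊆v → from (inside∷-⊆⇔ v s) s⊆v , ∣⊥∣≡0 (suc n)))
                (count-⊆ v)) ⟩
  2 ^ ∣ v ∣ ∎
  where open ≡-Reasoning
count-remaining {suc n} (inside ∷ v) (suc j) = begin
  count (remaining? (inside ∷ v) (suc j)) (subsets (suc n)) ≡⟨ count-subsets (remaining? (inside ∷ v) (suc j)) ⟩
  _ ≡⟨ cong₂ _+_
         (trans (count-⇔ _ (remaining? v j) (subsets n) λ s →
                   mk⇔ (Product.map (to (outside∷-⊆⇔ v s)) ℕ.suc-injective)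
                       (Product.map (from (outside∷-⊆⇔ v s)) (cong suc)))
                (count-remaining v j))
         (count-none _ (subsets n) λ { s (_ , eq) → ℕ.1+n≢0 (trans (sym eq) (∣⊥∣≡0 (suc n))) }) ⟩
  weight j ∣ v ∣ + 0 ≡⟨ ℕ.+-identityʳ _ ⟩
  weight j ∣ v ∣     ∎
  where open ≡-Reasoning

-- Vectors with a last entry, and extreme elements of subsets.

lookup-∷ʳ-inject₁ : ∀ {a} {A : Set a} {n} (xs : Vec A n) x k → lookup (xs ∷ʳ x) (inject₁ k) ≡ lookup xs k
lookup-∷ʳ-inject₁ (y ∷ xs) x zero    = refl
lookup-∷ʳ-inject₁ (y ∷ xs) x (suc k) = lookup-∷ʳ-inject₁ xs x k

lookup-∷ʳ-fromℕ : ∀ {a} {A : Set a} {n} (xs : Vec A n) x → lookup (xs ∷ʳ x) (fromℕ n) ≡ x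
lookup-∷ʳ-fromℕ []       x = refl
lookup-∷ʳ-fromℕ (y ∷ xs) x = lookup-∷ʳ-fromℕ xs x

lookup-injective : ∀ {a} {A : Set a} {n} (xs ys : Vec A n) → (∀ k → lookup xs k ≡ lookup ys k) → xs ≡ ys
lookup-injective xs ys eq =
  trans (sym (Vec.tabulate∘lookup xs)) (trans (Vec.tabulate-cong eq) (Vec.tabulate∘lookup ys))

module _ {n : ℕ} {p : Subset n} {b : Bool} where

  inject₁∈∷ʳ⁺ : ∀ {k} → k ∈ p → inject₁ k ∈ p ∷ʳ b
  inject₁∈∷ʳ⁺ {k} k∈p = Vec.lookup⇒[]= _ _ (trans (lookup-∷ʳ-inject₁ p b k) (Vec.[]=⇒lookup k∈p))

  inject₁∈∷ʳ⁻ : ∀ {k} → inject₁ k ∈ p ∷ʳ b → k ∈ p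
  inject₁∈∷ʳ⁻ {k} k∈p = Vec.lookup⇒[]= _ _ (trans (sym (lookup-∷ʳ-inject₁ p b k)) (Vec.[]=⇒lookup k∈p))

fromℕ∈∷ʳinside : ∀ {n} (p : Subset n) → fromℕ n ∈ p ∷ʳ inside
fromℕ∈∷ʳinside p = Vec.lookup⇒[]= _ _ (lookup-∷ʳ-fromℕ p inside)

fromℕ∉∷ʳoutside : ∀ {n} (p : Subset n) → fromℕ n ∉ p ∷ʳ outside
fromℕ∉∷ʳoutside p n∈ with () ← trans (sym (lookup-∷ʳ-fromℕ p outside)) (Vec.[]=⇒lookup n∈)

init∷ʳinside : ∀ {n} (p : Subset (suc n)) → fromℕ n ∈ p → init p ∷ʳ inside ≡ p
init∷ʳinside {zero}  (inside ∷ []) here       = refl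
init∷ʳinside {suc n} (b ∷ p)       (there n∈) = cong (b ∷_) (init∷ʳinside p n∈)

init∷ʳoutside : ∀ {n} (p : Subset (suc n)) → fromℕ n ∉ p → init p ∷ʳ outside ≡ p
init∷ʳoutside {zero}  (inside  ∷ []) n∉ = contradiction here n∉
init∷ʳoutside {zero}  (outside ∷ []) n∉ = refl
init∷ʳoutside {suc n} (b ∷ p)        n∉ = cong (b ∷_) (init∷ʳoutside p (n∉ ∘ there))

∈init⇔ : ∀ {n} (p : Subset (suc n)) {k} → k ∈ init p ⇔ inject₁ k ∈ p
∈init⇔ {suc n} (b ∷ p) {zero}  = mk⇔ (λ { here → here }) (λ { here → here })
∈init⇔ {suc n} (b ∷ p) {suc k} =
  mk⇔ (λ { (there k∈) → there (to (∈init⇔ p) k∈) }) (λ { (there k∈) → there (from (∈init⇔ p) k∈) })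

⁅inject₁⁆ : ∀ {n} (k : Fin n) → ⁅ inject₁ k ⁆ ≡ ⁅ k ⁆ ∷ʳ outside
⁅inject₁⁆ zero    = cong (inside ∷_) ⊥∷ʳ
  where
  ⊥∷ʳ : ∀ {n} → ⊥ {suc n} ≡ ⊥ {n} ∷ʳ outside
  ⊥∷ʳ {zero}  = refl
  ⊥∷ʳ {suc n} = cong (outside ∷_) ⊥∷ʳ
⁅inject₁⁆ (suc k) = cong (outside ∷_) (⁅inject₁⁆ k)

inject₁<⇔ : ∀ {n} {k l : Fin n} → inject₁ k Fin.< inject₁ l ⇔ k Fin.< l
inject₁<⇔ {k = k} {l} = mk⇔
  (subst₂ ℕ._<_ (Fin.toℕ-inject₁ k) (Fin.toℕ-inject₁ l))
  (subst₂ ℕ._<_ (sym (Fin.toℕ-inject₁ k)) (sym (Fin.toℕ-inject₁ l)))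

inject₁<fromℕ : ∀ {n} (k : Fin n) → inject₁ k Fin.< fromℕ n
inject₁<fromℕ k = subst₂ ℕ._<_ (sym (Fin.toℕ-inject₁ k)) (sym (Fin.toℕ-fromℕ _)) (Fin.toℕ<n k)

<⇒inject₁ : ∀ {n} {k l : Fin (suc n)} → k Fin.< l → ∃ λ k′ → k ≡ inject₁ k′
<⇒inject₁ {k = k} {l} k<l with view k
... | ‵fromℕ      = contradiction (ℕ.<-≤-trans k<l (Fin.≤fromℕ l)) (ℕ.<-irrefl refl)
... | ‵inject₁ k′ = k′ , refl

least : ∀ {n} (p : Subset n) → Nonempty p → ∃ λ m → m ∈ p × (∀ x → x ∈ p → m Fin.≤ x)
least (inside ∷ p)  _                 = zero , here , λ _ _ → z≤n
least (outside ∷ p) (suc x , there x∈p) with m , m∈p , m≤ ← least p (x , x∈p) =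
  suc m , there m∈p , λ { (suc y) (there y∈p) → s≤s (m≤ y y∈p) }

greatest : ∀ {n} (p : Subset n) → Nonempty p → ∃ λ m → m ∈ p × (∀ x → x ∈ p → x Fin.≤ m)
greatest (b ∷ p) (x , x∈) with nonempty? p
... | yes ne with m , m∈p , ≤m ← greatest p ne =
  suc m , there m∈p , λ { zero _ → z≤n ; (suc y) (there y∈p) → s≤s (≤m y y∈p) }
greatest (b ∷ p) (suc x , there x∈) | no ∅ = contradiction (x , x∈) ∅
greatest (b ∷ p) (zero , x∈) | no ∅ =
  zero , x∈ , λ { zero _ → z≤n ; (suc y) (there y∈p) → contradiction (y , y∈p) ∅ }

-- Visibility from the additional vertex in combinatorial form.

module _ {i : ℕ} (π : BlockMap i) where

  -- All pairs in a block are used, not only the sides of its polygon: this form needs no minimality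
  -- or maximality of endpoints and behaves well when blocks are extended.
  Uncovered : Fin i → Set
  Uncovered k = ∀ a b → a Fin.< k → k Fin.< b → b ∉ block π a

  uncovered? : Decidable Uncovered
  uncovered? k = Fin.all? λ a → Fin.all? λ b →
    a Fin.<? k →-dec (k Fin.<? b →-dec ¬? (b ∈? block π a))

  visibleIsolated : Subset i
  visibleIsolated = tabulate λ k → ⌊ isolated? π k ×-dec uncovered? k ⌋

  ∈visibleIsolated⇔ : ∀ k → (Isolated π k × Uncovered k) ⇔ k ∈ visibleIsolated
  ∈visibleIsolated⇔ k = mk⇔
    (λ v → Vec.lookup⇒[]= k _ (trans (Vec.lookup∘tabulate _ k) (to T-≡ (fromWitness {a? = d?} v))))
    (λ k∈ → toWitness {a? = d?} (from T-≡ (trans (sym (Vec.lookup∘tabulate _ k)) (Vec.[]=⇒lookup k∈))))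
    where d? = isolated? π k ×-dec uncovered? k

-- The side joining the first to the last vertex of a block covers whatever any
-- two vertices of the block cover.
spanning-edge : ∀ {i : ℕ} (π : BlockMap i) → IsPartition π →
  ∀ {a b k : Fin i} → a Fin.< k → k Fin.< b → b ∈ block π a →
  ∃₂ λ m M → m Fin.< k × k Fin.< M × IsEdge π m M
spanning-edge π (refl-π , block-π) {a} {b} a<k k<b b∈a
  with m , m∈a , m≤ ← least (block π a) (a , refl-π a)
     | M , M∈a , ≤M ← greatest (block π a) (a , refl-π a) =
  m , M , m<k , k<M , ℕ.<-trans m<k k<M
  , subst (M ∈_) (sym m≡a) M∈a
  , inj₂ (λ c c∈m → let c∈a = subst (c ∈_) m≡a c∈m in m≤ c c∈a , ≤M c c∈a)
  where
  m<k = ℕ.≤-<-trans (m≤ a (refl-π a)) a<k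
  k<M = ℕ.<-≤-trans k<b (≤M b b∈a)
  m≡a = block-π a m m∈a

module _ {c ℓ₁ ℓ₂ : Level} (F : OrderedField c ℓ₁ ℓ₂) where

  module _ {m : ℕ} (S : ConvexPointSet F m) {k n a b : Fin m}
           (k<n : k Fin.< n) (b<n : b Fin.< n) (a<b : a Fin.< b) where
    open ConvexPointSet S

    private
      Meets = MeetsInterior F (pt k) (pt n) (pt a) (pt b)

    -- meetsInterior? decides by comparing indices, so unfolding it settles the
    -- geometry.
    covered⇒meets : a Fin.< k → k Fin.< b → Meets
    covered⇒meets a<k k<b = toWitness {a? = meetsInterior? F S k<n b<n a<b} decided
      where
      decided : True (meetsInterior? F S k<n b<n a<b)
      decided with Fin.<-cmp a k | Fin.<-cmp k b
      ... | tri< _ _ _   | tri< _ _ _   = _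
      ... | tri< _ _ _   | tri≈ ¬k<b _ _ = contradiction k<b ¬k<b
      ... | tri< _ _ _   | tri> ¬k<b _ _ = contradiction k<b ¬k<b
      ... | tri≈ ¬a<k _ _ | _            = contradiction a<k ¬a<k
      ... | tri> ¬a<k _ _ | _            = contradiction a<k ¬a<k

    meets⇒covered : Meets → a Fin.< k × k Fin.< b
    meets⇒covered meets = decided (fromWitness {a? = meetsInterior? F S k<n b<n a<b} meets)
      where
      decided : True (meetsInterior? F S k<n b<n a<b) → a Fin.< k × k Fin.< b
      decided t with Fin.<-cmp a k | Fin.<-cmp k b
      ... | tri< a<k _ _  | tri< k<b _ _   = a<k , k<b
      ... | tri< _ _ _    | tri≈ _ refl _ = contradiction t id
      ... | tri< _ _ _    | tri> _ _ _    = contradiction t id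
      ... | tri≈ _ refl _ | _             = contradiction t id
      ... | tri> _ _ _    | _             = contradiction t id

  module _ {i : ℕ} (S : ConvexPointSet F (suc i)) (π : BlockMap i) (partition : IsPartition π) where

    -- A covering pair may be a diagonal that is not drawn, so it is first replaced by the spanning
    -- side of its block, which is drawn and blocks the view. Conversely, the ends of a blocking
    -- edge are themselves a covering pair.
    visible⇔uncovered : ∀ k → Visible F S π (vertex F S k) (extra F S) ⇔ Uncovered π k
    visible⇔uncovered k = mk⇔
      (λ visible a b a<k k<b b∈a →
        let m , M , m<k , k<M , edge = spanning-edge π partition a<k k<b b∈a in
        visible m M edge (covered⇒meets S (inject₁<fromℕ k) (inject₁<fromℕ M)
          (from inject₁<⇔ (proj₁ edge)) (from inject₁<⇔ m<k) (from inject₁<⇔ k<M)))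
      (λ uncovered a b edge meets →
        let a<k , k<b = meets⇒covered S (inject₁<fromℕ k) (inject₁<fromℕ b) (from inject₁<⇔ (proj₁ edge)) meets in
        uncovered a b (to inject₁<⇔ a<k) (to inject₁<⇔ k<b) (proj₁ (proj₂ edge)))

    -- The right-hand side is free of `S`: the degree does not depend on the chosen points, so `S`
    -- and `T` in the theorem may be unrelated.
    isolationDegree≡ : isolationDegree F S π ≡ ∣ visibleIsolated π ∣
    isolationDegree≡ = count-tabulate _ id (visibleIsolated π) λ k → mk⇔
      (λ (iso , vis) → to (∈visibleIsolated⇔ π k) (iso , to (visible⇔uncovered k) vis))
      (λ k∈ → let iso , unc = from (∈visibleIsolated⇔ π k) k∈ in iso , from (visible⇔uncovered k) unc)

-- Joining a new last vertex to a set of visible isolated vertices.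

inject₁-block : ∀ {n} → Subset n → Subset n → Bool → Subset (suc n)
inject₁-block s p true  = s ∷ʳ inside
inject₁-block s p false = p ∷ʳ outside

inject₁-blocks : ∀ {i} → BlockMap i → Subset i → Vec (Subset (suc i)) i
inject₁-blocks π s = tabulate λ k → inject₁-block s (block π k) (lookup s k)

-- The new last vertex is joined to the elements of s.
extend : ∀ {i} → BlockMap i → Subset i → BlockMap (suc i)
extend π s = inject₁-blocks π s ∷ʳ (s ∷ʳ inside)

∉⇒lookup : ∀ {n} {p : Subset n} {k} → k ∉ p → lookup p k ≡ outside
∉⇒lookup {p = p} {k} k∉p with lookup p k in eq
... | true  = contradiction (Vec.lookup⇒[]= k p eq) k∉p
... | false = refl

module _ {i : ℕ} (π : BlockMap i) (s : Subset i) where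

  block-extend-fromℕ : block (extend π s) (fromℕ i) ≡ s ∷ʳ inside
  block-extend-fromℕ = lookup-∷ʳ-fromℕ (inject₁-blocks π s) _

  private
    block-extend-inject₁ : ∀ k → block (extend π s) (inject₁ k) ≡ inject₁-block s (block π k) (lookup s k)
    block-extend-inject₁ k = trans (lookup-∷ʳ-inject₁ (inject₁-blocks π s) _ k) (Vec.lookup∘tabulate _ k)

  block-extend-∈ : ∀ {k} → k ∈ s → block (extend π s) (inject₁ k) ≡ s ∷ʳ inside
  block-extend-∈ {k} k∈s =
    trans (block-extend-inject₁ k) (cong (inject₁-block s (block π k)) (Vec.[]=⇒lookup k∈s))

  block-extend-∉ : ∀ {k} → k ∉ s → block (extend π s) (inject₁ k) ≡ block π k ∷ʳ outside
  block-extend-∉ {k} k∉s =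
    trans (block-extend-inject₁ k) (cong (inject₁-block s (block π k)) (∉⇒lookup k∉s))

  -- The new vertex is grouped with the elements of `s`, so that later proofs split into two cases
  -- instead of three.
  data ExtendedBlock : Fin (suc i) → Set where
    joined   : ∀ {x} → x ∈ s ∷ʳ inside → block (extend π s) x ≡ s ∷ʳ inside → ExtendedBlock x
    unjoined : ∀ k → k ∉ s → block (extend π s) (inject₁ k) ≡ block π k ∷ʳ outside → ExtendedBlock (inject₁ k)

  extendedBlock : ∀ x → ExtendedBlock x
  extendedBlock x with view x
  ... | ‵fromℕ = joined (fromℕ∈∷ʳinside s) block-extend-fromℕ
  ... | ‵inject₁ k with k ∈? s
  ...   | yes k∈s = joined (inject₁∈∷ʳ⁺ k∈s) (block-extend-∈ k∈s)
  ...   | no  k∉s = unjoined k k∉s (block-extend-∉ k∉s)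

∈∷ʳoutside⁻ : ∀ {n} {p : Subset n} {x} → x ∈ p ∷ʳ outside → ∃ λ k → x ≡ inject₁ k × k ∈ p
∈∷ʳoutside⁻ {p = p} {x} x∈ with view x
... | ‵fromℕ     = contradiction x∈ (fromℕ∉∷ʳoutside p)
... | ‵inject₁ k = k , refl , inject₁∈∷ʳ⁻ x∈

module _ {i : ℕ} (π : BlockMap i) (s : Subset i)
         (partition : IsPartition π) (s⊆v : s ⊆ visibleIsolated π) where

  private
    isolated : ∀ {k} → k ∈ s → Isolated π k
    isolated k∈s = proj₁ (from (∈visibleIsolated⇔ π _) (s⊆v k∈s))

    uncovered : ∀ {k} → k ∈ s → Uncovered π k
    uncovered k∈s = proj₂ (from (∈visibleIsolated⇔ π _) (s⊆v k∈s))

    -- An `l` in `s` forms a singleton block, so a vertex `k` sharing its block would be `l` itself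
    -- and lie in `s`.
    ∈block-unjoined : ∀ {k l} → k ∉ s → l ∈ block π k → l ∉ s
    ∈block-unjoined {k} {l} k∉s l∈k l∈s = k∉s (subst (_∈ s) (sym k≡l) l∈s)
      where
      k≡l : k ≡ l
      k≡l = x∈⁅y⁆⇒x≡y l (subst (k ∈_) (trans (sym (proj₂ partition k l l∈k)) (isolated l∈s)) (proj₁ partition k))

  extend-partition : IsPartition (extend π s)
  extend-partition = refl-ext , block-ext
    where
    refl-ext : ∀ x → x ∈ block (extend π s) x
    refl-ext x with extendedBlock π s x
    ... | joined x∈ eq     = subst (x ∈_) (sym eq) x∈
    ... | unjoined k _ eq = subst (inject₁ k ∈_) (sym eq) (inject₁∈∷ʳ⁺ (proj₁ partition k))

    block-ext : ∀ x y → y ∈ block (extend π s) x → block (extend π s) y ≡ block (extend π s) x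
    block-ext x y y∈ with extendedBlock π s x
    block-ext x y y∈ | joined x∈ eq with extendedBlock π s y
    ... | joined _ eq′      = trans eq′ (sym eq)
    ... | unjoined l l∉s _ = contradiction (inject₁∈∷ʳ⁻ (subst (inject₁ l ∈_) eq y∈)) l∉s
    block-ext x y y∈ | unjoined k k∉s eq with ∈∷ʳoutside⁻ (subst (y ∈_) eq y∈)
    ... | l , refl , l∈k =
      trans (block-extend-∉ π s (∈block-unjoined k∉s l∈k))
            (trans (cong (_∷ʳ outside) (proj₂ partition k l l∈k)) (sym eq))

  -- Two old blocks do not cross by assumption. A crossing of an old block with the new one would
  -- put an element of `s` strictly between two vertices of the old block, although elements of `s`
  -- are uncovered.
  extend-nonCrossing : IsNonCrossing π → IsNonCrossing (extend π s)
  extend-nonCrossing nc a b c d a<b b<c c<d c∈a d∈b with extendedBlock π s a | extendedBlock π s b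
  ... | joined _ eqᵃ | joined _ eqᵇ = trans eqᵃ (sym eqᵇ)
  ... | joined _ eqᵃ | unjoined b′ _ eqᵇ
      with ∈∷ʳoutside⁻ (subst (d ∈_) eqᵇ d∈b) | <⇒inject₁ c<d
  -- Here `c` precedes `d`, so it is not the new vertex but an element of `s`, and `b′`, `d′` cover
  -- it.
  ...   | d′ , refl , d∈b′ | c′ , refl = contradiction d∈b′
          (uncovered (inject₁∈∷ʳ⁻ (subst (c ∈_) eqᵃ c∈a)) b′ d′ (to inject₁<⇔ b<c) (to inject₁<⇔ c<d))
  extend-nonCrossing nc a b c d a<b b<c c<d c∈a d∈b | unjoined a′ _ eqᵃ | joined b∈ _
      with ∈∷ʳoutside⁻ (subst (c ∈_) eqᵃ c∈a) | <⇒inject₁ b<c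
  -- Now `b` is the element of `s`, covered by `a′` and `c′`.
  ...   | c′ , refl , c∈a′ | b′ , refl = contradiction c∈a′
          (uncovered (inject₁∈∷ʳ⁻ b∈) a′ c′ (to inject₁<⇔ a<b) (to inject₁<⇔ b<c))
  extend-nonCrossing nc a b c d a<b b<c c<d c∈a d∈b | unjoined a′ _ eqᵃ | unjoined b′ _ eqᵇ
      with ∈∷ʳoutside⁻ (subst (c ∈_) eqᵃ c∈a) | ∈∷ʳoutside⁻ (subst (d ∈_) eqᵇ d∈b)
  ...   | c′ , refl , c∈a′ | d′ , refl , d∈b′ = trans eqᵃ (trans (cong (_∷ʳ outside)
          (nc a′ b′ c′ d′ (to inject₁<⇔ a<b) (to inject₁<⇔ b<c) (to inject₁<⇔ c<d) c∈a′ d∈b′)) (sym eqᵇ))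

  private
    v = visibleIsolated π

    ∈extend-inject₁ : ∀ {a b} → b ∈ block π a → inject₁ b ∈ block (extend π s) (inject₁ a) ⊎ a ∈ s
    ∈extend-inject₁ {a} b∈a with a ∈? s
    ... | yes a∈s = inj₂ a∈s
    ... | no  a∉s = inj₁ (subst (_ ∈_) (sym (block-extend-∉ π s a∉s)) (inject₁∈∷ʳ⁺ b∈a))

    fromℕ∈extend : ∀ {k} → k ∈ s → fromℕ i ∈ block (extend π s) (inject₁ k)
    fromℕ∈extend k∈s = subst (fromℕ i ∈_) (sym (block-extend-∈ π s k∈s)) (fromℕ∈∷ʳinside s)

    inject₁⇒remaining : ∀ k → Isolated (extend π s) (inject₁ k) → Uncovered (extend π s) (inject₁ k) →
                        inject₁ k ∈ remaining v s
    inject₁⇒remaining k iso unc =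
      inject₁∈remaining⁺ v s (to (∈visibleIsolated⇔ π k) (iso-π , unc-π)) before
      where
      k∉s : k ∉ s
      k∉s k∈s = Fin.fromℕ≢inject₁
        (x∈⁅y⁆⇒x≡y _ (subst (fromℕ i ∈_) iso (fromℕ∈extend k∈s)))

      iso-π : Isolated π k
      iso-π = Vec.∷ʳ-injectiveˡ _ _ (trans (sym (block-extend-∉ π s k∉s)) (trans iso (⁅inject₁⁆ k)))

      before : ∀ l → l ∈ s → k Fin.< l
      before l l∈s with Fin.<-cmp k l
      ... | tri< k<l _ _ = k<l
      ... | tri≈ _ refl _ = contradiction l∈s k∉s
      -- An element `l` of `s` before `k` would cover `k` together with the new vertex.
      ... | tri> _ _ l<k = contradiction (fromℕ∈extend l∈s)
              (unc (inject₁ l) (fromℕ i) (from inject₁<⇔ l<k) (inject₁<fromℕ k))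

      unc-π : Uncovered π k
      unc-π a b a<k k<b b∈a with ∈extend-inject₁ b∈a
      ... | inj₁ b∈a⁺ = unc (inject₁ a) (inject₁ b) (from inject₁<⇔ a<k) (from inject₁<⇔ k<b) b∈a⁺
      ... | inj₂ a∈s  = ℕ.<-asym (before a a∈s) a<k

    remaining⇒inject₁ : ∀ k → inject₁ k ∈ remaining v s →
                        Isolated (extend π s) (inject₁ k) × Uncovered (extend π s) (inject₁ k)
    remaining⇒inject₁ k k∈ =
      trans (block-extend-∉ π s (λ k∈s → ℕ.<-irrefl refl (before k k∈s)))
            (trans (cong (_∷ʳ outside) (proj₁ visible)) (sym (⁅inject₁⁆ k)))
      , unc
      where
      before = proj₂ (inject₁∈remaining⁻ v s k∈)
      visible = from (∈visibleIsolated⇔ π k) (proj₁ (inject₁∈remaining⁻ v s k∈))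

      unc : Uncovered (extend π s) (inject₁ k)
      unc a b a<k k<b b∈a with extendedBlock π s a
      ... | unjoined a′ _ eq with b′ , refl , b∈a′ ← ∈∷ʳoutside⁻ (subst (b ∈_) eq b∈a) =
        proj₂ visible a′ b′ (to inject₁<⇔ a<k) (to inject₁<⇔ k<b) b∈a′
      -- As `a` precedes `k`, it is an old vertex and so an element of `s`, yet `k` precedes all of
      -- `s`.
      ... | joined a∈ _ with a′ , refl ← <⇒inject₁ a<k =
        ℕ.<-asym (before a′ (inject₁∈∷ʳ⁻ a∈)) (to inject₁<⇔ a<k)

    -- Nothing lies beyond the new vertex, so it is never covered; only its isolation depends on
    -- `s`.
    fromℕ⇔remaining : (Isolated (extend π s) (fromℕ i) × Uncovered (extend π s) (fromℕ i)) ⇔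
                      fromℕ i ∈ remaining v s
    fromℕ⇔remaining = mk⇔
      (λ (iso , _) → from (fromℕ∈remaining⇔ v s) λ (k , k∈s) → Fin.fromℕ≢inject₁ (sym
        (x∈⁅y⁆⇒x≡y _ (subst (inject₁ k ∈_) (trans (sym (block-extend-fromℕ π s)) iso) (inject₁∈∷ʳ⁺ k∈s)))))
      (λ n∈ → trans (block-extend-fromℕ π s)
                (trans (cong (_∷ʳ inside) (Empty-unique (to (fromℕ∈remaining⇔ v s) n∈))) ⊥∷ʳinside)
            , λ a b _ n<b _ → contradiction (ℕ.<-≤-trans n<b (Fin.≤fromℕ b)) (ℕ.<-irrefl refl))
      where
      ⊥∷ʳinside : ∀ {n} → ⊥ {n} ∷ʳ inside ≡ ⁅ fromℕ n ⁆
      ⊥∷ʳinside {zero}  = refl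
      ⊥∷ʳinside {suc n} = cong (outside ∷_) ⊥∷ʳinside

  -- The degree of an extension is thus determined by `v` and `s` alone, which reduces counting
  -- extensions to `count-remaining`.
  visibleIsolated-extend : visibleIsolated (extend π s) ≡ remaining v s
  visibleIsolated-extend = ⊆-antisym
    (λ {x} x∈ → ⇒remaining x (from (∈visibleIsolated⇔ (extend π s) x) x∈))
    (λ {x} x∈ → to (∈visibleIsolated⇔ (extend π s) x) (remaining⇒ x x∈))
    where
    ⇒remaining : ∀ x → Isolated (extend π s) x × Uncovered (extend π s) x → x ∈ remaining v s
    ⇒remaining x vis with view x
    ... | ‵fromℕ     = to fromℕ⇔remaining vis
    ... | ‵inject₁ k = uncurry (inject₁⇒remaining k) vis

    remaining⇒ : ∀ x → x ∈ remaining v s → Isolated (extend π s) x × Uncovered (extend π s) x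
    remaining⇒ x x∈ with view x
    ... | ‵fromℕ     = from fromℕ⇔remaining x∈
    ... | ‵inject₁ k = remaining⇒inject₁ k x∈

-- The block of the new vertex reveals `s`, and blocks outside `s` are kept. Blocks at elements of
-- `s` are overwritten, but the inclusions force them to have been singletons.
extend-injective : ∀ {i} {π π′ : BlockMap i} {s s′} → s ⊆ visibleIsolated π → s′ ⊆ visibleIsolated π′ →
                   extend π s ≡ extend π′ s′ → (π , s) ≡ (π′ , s′)
extend-injective {i} {π} {π′} {s} {s′} s⊆v s′⊆v′ eq
  with refl ← Vec.∷ʳ-injectiveˡ s s′ (Vec.∷ʳ-injectiveʳ _ _ eq) =
  cong (_, s) (lookup-injective π π′ same)
  where
  same : ∀ k → block π k ≡ block π′ k
  same k with k ∈? s
  ... | yes k∈s = trans (proj₁ (from (∈visibleIsolated⇔ π k) (s⊆v k∈s)))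
                        (sym (proj₁ (from (∈visibleIsolated⇔ π′ k) (s′⊆v′ k∈s))))
  ... | no  k∉s = Vec.∷ʳ-injectiveˡ _ _ (trans (sym (block-extend-∉ π s k∉s))
                    (trans (cong (λ σ → block σ (inject₁ k)) eq) (block-extend-∉ π′ s k∉s)))

-- Removing the last vertex, the inverse of joining it.

module _ {i : ℕ} (σ : BlockMap (suc i)) where

  joinedTo : Subset i
  joinedTo = init (block σ (fromℕ i))

  restrict : BlockMap i
  restrict = tabulate λ k → if lookup joinedTo k then ⁅ k ⁆ else init (block σ (inject₁ k))

  block-restrict-∈ : ∀ {k} → k ∈ joinedTo → block restrict k ≡ ⁅ k ⁆
  block-restrict-∈ {k} k∈ = trans (Vec.lookup∘tabulate _ k)
    (cong (λ b → if b then ⁅ k ⁆ else init (block σ (inject₁ k))) (Vec.[]=⇒lookup k∈))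

  block-restrict-∉ : ∀ {k} → k ∉ joinedTo → block restrict k ≡ init (block σ (inject₁ k))
  block-restrict-∉ {k} k∉ = trans (Vec.lookup∘tabulate _ k)
    (cong (λ b → if b then ⁅ k ⁆ else init (block σ (inject₁ k))) (∉⇒lookup k∉))

  module _ (partition : IsPartition σ) where

    private
      refl-σ = proj₁ partition
      block-σ = proj₂ partition
      N = fromℕ i

      joined-block : ∀ {k} → k ∈ joinedTo → block σ (inject₁ k) ≡ block σ N
      joined-block k∈ = block-σ N _ (to (∈init⇔ (block σ N)) k∈)

      block⇒joined : ∀ {k} → block σ (inject₁ k) ≡ block σ N → k ∈ joinedTo
      block⇒joined {k} eq = from (∈init⇔ (block σ N)) (subst (inject₁ k ∈_) eq (refl-σ (inject₁ k)))

      ∈restrict-∉ : ∀ {k l} → k ∉ joinedTo → l ∈ block restrict k → inject₁ l ∈ block σ (inject₁ k)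
      ∈restrict-∉ {k} {l} k∉ l∈ = to (∈init⇔ (block σ (inject₁ k))) (subst (l ∈_) (block-restrict-∉ k∉) l∈)

      ∈restrict-∈ : ∀ {k l} → k ∈ joinedTo → l ∈ block restrict k → l ≡ k
      ∈restrict-∈ {k} {l} k∈ l∈ = x∈⁅y⁆⇒x≡y k (subst (l ∈_) (block-restrict-∈ k∈) l∈)

    extend-restrict : extend restrict joinedTo ≡ σ
    extend-restrict = lookup-injective _ σ same
      where
      same : ∀ x → block (extend restrict joinedTo) x ≡ block σ x
      same x with view x
      ... | ‵fromℕ = trans (block-extend-fromℕ restrict joinedTo) (init∷ʳinside (block σ N) (refl-σ N))
      ... | ‵inject₁ k with k ∈? joinedTo
      ...   | yes k∈ = trans (block-extend-∈ restrict joinedTo k∈)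
                         (trans (init∷ʳinside (block σ N) (refl-σ N)) (sym (joined-block k∈)))
      ...   | no  k∉ = trans (block-extend-∉ restrict joinedTo k∉)
                         (trans (cong (_∷ʳ outside) (block-restrict-∉ k∉))
                           -- Appending `outside` restores the block, since a block containing `N`
                           -- would make `k` joined.
                           (init∷ʳoutside _ λ N∈k → k∉ (block⇒joined (sym (block-σ _ N N∈k)))))

    restrict-partition : IsPartition restrict
    restrict-partition = refl-restrict , block-restrict
      where
      refl-restrict : ∀ k → k ∈ block restrict k
      refl-restrict k with k ∈? joinedTo
      ... | yes k∈ = subst (k ∈_) (sym (block-restrict-∈ k∈)) (x∈⁅x⁆ k)
      ... | no  k∉ = subst (k ∈_) (sym (block-restrict-∉ k∉)) (from (∈init⇔ (block σ (inject₁ k))) (refl-σ (inject₁ k)))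

      block-restrict : ∀ k l → l ∈ block restrict k → block restrict l ≡ block restrict k
      block-restrict k l l∈ with k ∈? joinedTo
      ... | yes k∈ = cong (block restrict) (∈restrict-∈ k∈ l∈)
      ... | no  k∉ = trans (block-restrict-∉ (λ l∈N → k∉ (block⇒joined (trans (sym same) (joined-block l∈N)))))
                       (trans (cong init same) (sym (block-restrict-∉ k∉)))
        where same = block-σ (inject₁ k) (inject₁ l) (∈restrict-∉ k∉ l∈)

    module _ (nonCrossing : IsNonCrossing σ) where

      restrict-nonCrossing : IsNonCrossing restrict
      restrict-nonCrossing a b c d a<b b<c c<d c∈a d∈b with a ∈? joinedTo | b ∈? joinedTo
      -- A joined vertex has become a singleton, which has no room for the later vertex `c`.
      ... | yes a∈ | _      = contradiction (∈restrict-∈ a∈ c∈a) (Fin.<⇒≢ (ℕ.<-trans a<b b<c) ∘ sym)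
      ... | no _   | yes b∈ = contradiction (∈restrict-∈ b∈ d∈b) (Fin.<⇒≢ (ℕ.<-trans b<c c<d) ∘ sym)
      ... | no a∉  | no b∉  = trans (block-restrict-∉ a∉) (trans (cong init
              (nonCrossing _ _ _ _ (from inject₁<⇔ a<b) (from inject₁<⇔ b<c) (from inject₁<⇔ c<d)
                 (∈restrict-∉ a∉ c∈a) (∈restrict-∉ b∉ d∈b)))
              (sym (block-restrict-∉ b∉)))

      -- If `a` and `b` shared a block around a joined `k`, then `a < k < b < N` would be a crossing
      -- with the block of `k` and `N`; non-crossing merges the two blocks, so `a` would be joined
      -- and its restricted block a singleton.
      joinedTo⊆visibleIsolated : joinedTo ⊆ visibleIsolated restrict
      joinedTo⊆visibleIsolated {k} k∈ = to (∈visibleIsolated⇔ restrict k) (block-restrict-∈ k∈ , unc)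
        where
        unc : Uncovered restrict k
        unc a b a<k k<b b∈a with a ∈? joinedTo
        ... | yes a∈ = Fin.<⇒≢ (ℕ.<-trans a<k k<b) (sym (∈restrict-∈ a∈ b∈a))
        ... | no  a∉ = a∉ (block⇒joined (trans
                (nonCrossing _ _ _ N (from inject₁<⇔ a<k) (from inject₁<⇔ k<b) (inject₁<fromℕ b)
                  (∈restrict-∉ a∉ b∈a) (subst (N ∈_) (sym (joined-block k∈)) (refl-σ N)))
                (joined-block k∈)))

-- Assembling the recurrence.

blockMaps-unique : ∀ i → Unique (blockMaps i)
blockMaps-unique i = vectors-unique (subsets-unique i) i

∈-blockMaps : ∀ {i} (π : BlockMap i) → π List.∈ blockMaps i
∈-blockMaps = ∈-vectors ∈-subsets

theorem15 : ∀ {c ℓ₁ ℓ₂} (F : OrderedField c ℓ₁ ℓ₂) (n : ℕ) → 3 ≤ n →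
    (i : ℕ) → 1 ≤ i → i + 2 ≤ n →
    (S : ConvexPointSet F (1 + i)) (T : ConvexPointSet F (2 + i)) →
    (j : Fin n) → degreeVector F n T j ≡ (B n *ᵥ degreeVector F n S) j
theorem15 F n _ i _ i+2≤n S T j = begin
  degreeVector F n T j
    -- Each non-crossing partition of the larger set is `extend π s` for exactly one admissible
    -- pair.
    ≡⟨ count-bijection extension? degree-j?
         (Unique.cartesianProduct⁺ (blockMaps-unique i) (subsets-unique i))
         (λ (π , s) → ∈-cartesianProduct⁺ (∈-blockMaps π) (∈-subsets s))
         (blockMaps-unique (suc i)) ∈-blockMaps
         (uncurry extend) extension⇒degree-j
         (λ (_ , s⊆v , _) (_ , s′⊆v′ , _) → extend-injective s⊆v s′⊆v′)
         degree-j⇒extension ⟨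
  count extension? (cartesianProduct (blockMaps i) (subsets i))
    -- The pairs are grouped by the degree `q` of `π`; each such `π` contributes
    -- `weight (toℕ j) (toℕ q)` sets.
    ≡⟨ count-cartesianProduct isNCPartition? extension? (subsets i) (isolationDegree F S) (weight (toℕ j))
         degree<n
         (λ π s → proj₁)
         fibre (blockMaps i) ⟩
  sum {n} (λ q → weight (toℕ j) (toℕ q) * degreeVector F n S q)
    ≡⟨ sum-cong-≗ {n} (λ q → cong (_* degreeVector F n S q) (B≡weight n j q)) ⟨
  (B n *ᵥ degreeVector F n S) j ∎
  where
  open ≡-Reasoning

  degree-j? : Decidable (λ σ → IsNCPartition σ × isolationDegree F T σ ≡ toℕ j)
  degree-j? σ = isNCPartition? σ ×-dec isolationDegree F T σ ℕ.≟ toℕ j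

  Extension : BlockMap i × Subset i → Set
  Extension (π , s) = IsNCPartition π × s ⊆ visibleIsolated π × ∣ remaining (visibleIsolated π) s ∣ ≡ toℕ j

  extension? : Decidable Extension
  extension? (π , s) = isNCPartition? π ×-dec remaining? (visibleIsolated π) (toℕ j) s

  degree-extend : ∀ π s → IsPartition π → s ⊆ visibleIsolated π →
                  isolationDegree F T (extend π s) ≡ ∣ remaining (visibleIsolated π) s ∣
  degree-extend π s partition s⊆v =
    trans (isolationDegree≡ F T (extend π s) (extend-partition π s partition s⊆v))
          (cong ∣_∣ (visibleIsolated-extend π s partition s⊆v))

  extension⇒degree-j : ∀ x → Extension x →
    IsNCPartition (uncurry extend x) × isolationDegree F T (uncurry extend x) ≡ toℕ j
  extension⇒degree-j (π , s) ((partition , nc) , s⊆v , eq) =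
    (extend-partition π s partition s⊆v , extend-nonCrossing π s partition s⊆v nc)
    , trans (degree-extend π s partition s⊆v) eq

  degree-j⇒extension : ∀ σ → IsNCPartition σ × isolationDegree F T σ ≡ toℕ j →
                       ∃ λ x → Extension x × uncurry extend x ≡ σ
  degree-j⇒extension σ ((partition , nc) , eq) = (π , s)
    , ((partition-π , restrict-nonCrossing σ partition nc) , s⊆v
      , trans (sym (degree-extend π s partition-π s⊆v)) (trans (cong (isolationDegree F T) π+s≡σ) eq))
    , π+s≡σ
    where
    π = restrict σ
    s = joinedTo σ
    partition-π = restrict-partition σ partition
    s⊆v = joinedTo⊆visibleIsolated σ partition nc
    π+s≡σ = extend-restrict σ partition

  -- The degree is at most `i`, and `i + 2 ≤ n`, so no partition falls outside the `n` entries of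
  -- the degree vector.
  degree<n : ∀ π → IsNCPartition π → isolationDegree F S π < n
  degree<n π nc = ℕ.≤-<-trans
    (ℕ.≤-trans (ℕ.≤-reflexive (isolationDegree≡ F S π (proj₁ nc))) (∣p∣≤n (visibleIsolated π)))
    (ℕ.<-≤-trans (ℕ.m<m+n i {2} (s≤s z≤n)) i+2≤n)

  fibre : ∀ π → IsNCPartition π →
          count (λ s → extension? (π , s)) (subsets i) ≡ weight (toℕ j) (isolationDegree F S π)
  fibre π nc = begin
    count (λ s → extension? (π , s)) (subsets i)
      ≡⟨ count-⇔ _ (remaining? (visibleIsolated π) (toℕ j)) (subsets i) (λ s → mk⇔ proj₂ (nc ,_)) ⟩
    count (remaining? (visibleIsolated π) (toℕ j)) (subsets i)
      ≡⟨ count-remaining (visibleIsolated π) (toℕ j) ⟩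
    weight (toℕ j) ∣ visibleIsolated π ∣
      ≡⟨ cong (weight (toℕ j)) (isolationDegree≡ F S π (proj₁ nc)) ⟨
    weight (toℕ j) (isolationDegree F S π) ∎
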